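{- Let $n\geq 4$ and let $A$ and $B$ be two $n\times n$ generalized tournament matrices. Suppose that $A$ is indecomposable. If $A$ and $B$ have equal corresponding principal minors of orders at most $4$, then $A=B$ or $A=B^{t}$.
   Context: A generalized tournament matrix of order $n$ is a real $n\times n$ matrix $M=(m_{ij})$ with nonnegative entries satisfying $M+M^{t}=J_n-I_n$ ($J_n$ the all-ones matrix, $I_n$ the identity). Write $[n]=\{1,\ldots,n\}$. A clan of $M$ is a subset $X\subseteq[n]$ such that for all $i,j\in X$ and $k\in[n]\setminus X$, $m_{ik}=m_{jk}$ and $m_{ki}=m_{kj}$. The empty set, singletons and $[n]$ are the trivial clans; $M$ is indecomposable if all its clans are trivial. -}

module Defs where

open import Algebra.Bundles using (CommutativeRing)
import Algebra.Properties.Semiring.Exp as Exp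
import Algebra.Properties.Semiring.Sum as Sum
open import Data.Bool.Base using (if_then_else_)
open import Data.Fin.Base using (Fin; zero; suc; toℕ; punchIn)
open import Data.Fin.Properties using (_≟_)
open import Data.Fin.Subset using (Subset; inside; outside; _∈_; _∉_; ⁅_⁆; ⊥; ⊤; ∣_∣)
open import Data.Nat.Base using (ℕ; zero; suc)
open import Data.Product.Base using (∃; ∃-syntax; _×_)
open import Data.Sum.Base using (_⊎_)
open import Data.Vec.Base using ([]; _∷_)
open import Data.Vec.Functional using (Vector; transpose)
open import Level using (Level; _⊔_) renaming (suc to lsuc)
open import Relation.Binary.Core using (Rel)
open import Relation.Binary.Structures using (IsDecTotalOrder)
open import Relation.Binary.PropositionalEquality.Core using (_≡_)
open import Relation.Nullary.Decidable.Core using (does)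
open import Relation.Nullary.Negation.Core using (¬_)
open import Relation.Unary using (Pred)

-- The axioms of the field ℝ, which determine it up to isomorphism.  They are
-- read classically: the order and the equality are decidable, and every
-- inhabited predicate that is bounded above has a supremum.
record CompleteOrderedField (c ℓ₁ ℓ₂ : Level) : Set (lsuc (c ⊔ ℓ₁ ⊔ ℓ₂)) where
  infix 4 _≤_
  field
    commutativeRing : CommutativeRing c ℓ₁

  open CommutativeRing commutativeRing public

  field
    0≉1 : ¬ (0# ≈ 1#)
    inverse : ∀ x → ¬ (x ≈ 0#) → ∃[ y ] x * y ≈ 1#

    _≤_ : Rel Carrier ℓ₂
    isDecTotalOrder : IsDecTotalOrder _≈_ _≤_
    +-monoˡ-≤ : ∀ z {x y} → x ≤ y → x + z ≤ y + z
    *-nonNeg : ∀ {x y} → 0# ≤ x → 0# ≤ y → 0# ≤ x * y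

  IsUpperBound : ∀ {p} → Pred Carrier p → Carrier → Set (c ⊔ ℓ₂ ⊔ p)
  IsUpperBound P u = ∀ x → P x → x ≤ u

  field
    supremum : (P : Pred Carrier (c ⊔ ℓ₁ ⊔ ℓ₂)) → ∃ P → ∃ (IsUpperBound P) →
               ∃[ s ] IsUpperBound P s × (∀ u → IsUpperBound P u → s ≤ u)

module Matrices {c ℓ₁ ℓ₂} (ℝ : CompleteOrderedField c ℓ₁ ℓ₂) where

  open CompleteOrderedField ℝ hiding (zero)
  open Exp semiring using (_^_)
  open Sum semiring using (sum)

  Matrix : ℕ → Set c
  Matrix n = Vector (Vector Carrier n) n

  infix 4 _≋_
  infix 9 _ᵗ

  _≋_ : ∀ {n} → Matrix n → Matrix n → Set ℓ₁
  A ≋ B = ∀ i j → A i j ≈ B i j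

  _ᵗ : ∀ {n} → Matrix n → Matrix n
  _ᵗ = transpose

  J I : ∀ n → Matrix n
  J n i j = 1#
  I n i j = if does (i ≟ j) then 1# else 0#

  -- Laplace expansion along the first row.
  det : ∀ {n} → Matrix n → Carrier
  det {zero}  M = 1#
  det {suc n} M = sum λ j → (- 1#) ^ toℕ j * (M zero j * det (λ k l → M (suc k) (punchIn j l)))

  -- The increasing enumeration of the elements of X.
  enumerate : ∀ {n} (X : Subset n) → Fin ∣ X ∣ → Fin n
  enumerate (inside  ∷ X) zero    = zero
  enumerate (inside  ∷ X) (suc i) = suc (enumerate X i)
  enumerate (outside ∷ X) i       = suc (enumerate X i)

  principalMinor : ∀ {n} → Matrix n → Subset n → Carrier
  principalMinor M X = det λ i j → M (enumerate X i) (enumerate X j)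

  record IsGeneralizedTournament {n} (M : Matrix n) : Set (ℓ₁ ⊔ ℓ₂) where
    field
      nonNegative : ∀ i j → 0# ≤ M i j
      M+Mᵗ≋J-I    : (λ i j → M i j + (M ᵗ) i j) ≋ (λ i j → J n i j - I n i j)

  IsClan : ∀ {n} → Matrix n → Subset n → Set ℓ₁
  IsClan M X = ∀ i j k → i ∈ X → j ∈ X → k ∉ X → (M i k ≈ M j k) × (M k i ≈ M k j)

  IsTrivial : ∀ {n} → Subset n → Set
  IsTrivial X = (X ≡ ⊥) ⊎ (∃[ i ] X ≡ ⁅ i ⁆) ⊎ (X ≡ ⊤)

  Indecomposable : ∀ {n} → Matrix n → Set ℓ₁
  Indecomposable M = ∀ X → IsClan M X → IsTrivial X

module Submission where

-- Put s i j = m i j − m j i, so that m i j = (1 + s i j) / 2 off the diagonal, and let s′ be the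
-- analogue for B.  The minors of order 2, 3, 4 say respectively that s′ i j = ± s i j, that
-- xy + yz + zx is the same for both matrices along each 3-cycle, and that the 4 × 4 Pfaffians
-- agree up to sign.  Colour a pair P if s′ = s ≠ 0 and R if s′ = − s ≠ 0.  By order 3, a triangle
-- with edges of both colours has two edges of one colour, its third edge has the other colour, and
-- the ends of that third edge look alike from the opposite vertex.
--
-- Suppose both colours occur.  An R-connected component is a clan, so indecomposability makes the
-- R-graph connected, and likewise the P-graph.  Let U be a maximal set on which one of the two
-- graphs, say R, is disconnected, let v₀ ∉ U, let p₀ ∈ U be joined to v₀ in P, and let F be the
-- R-component of p₀ in U.  With u = s p₀ v₀, all of F is joined to U ∖ F in P with value u.  Every
-- v ∉ U has R-edges to F and to U ∖ F, all with one value s v r = w, and w = ± u by the Pfaffian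
-- condition.  If w = u then s v x = u on U ∖ F (v is above); otherwise s x v = u on F (v is below).
-- A check of triangles gives s a b = u for a above and b below, so F together with the vertices
-- above is cut off from the rest by the constant u: both sides are clans, a contradiction.
open import Defs
open import Data.Fin.Subset using (Subset; ∣_∣)
open import Data.Nat using (ℕ; _≤_)
open import Data.Sum using (_⊎_)
import Algebra.Properties.Ring as RingProperties
import Algebra.Properties.Semiring.Exp as Exp
import Algebra.Properties.Semiring.Mult.TCOptimised as Mult
import Algebra.Properties.Semiring.Sum as RingSum
import Algebra.Solver.Ring as RingSolver
open import Algebra.Bundles using (CommutativeRing)
open import Algebra.Solver.Ring.AlmostCommutativeRing
  using (fromCommutativeRing; _-Raw-AlmostCommutative⟶_)
open import Data.Bool.Base using (if_then_else_)
open import Data.Empty using (⊥)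
open import Data.Fin.Base as Fin using (Fin; zero; suc; toℕ; punchIn)
open import Data.Fin.Patterns using (0F; 1F; 2F; 3F)
open import Data.Fin.Properties as Fin using (any?; all?; pigeonhole)
open import Data.Fin.Subset using (inside; outside; _∈_; _∉_; _⊆_; _∩_; _∪_; ∁; ⁅_⁆; ⊤)
open import Data.Fin.Subset.Properties
  using (_∈?_; ∉⊥; ∈⊤; ⊆⊤; ⊆-antisym; x∈⁅x⁆; x∈⁅y⁆⇒x≡y; x∈p∪q⁻; p⊆p∪q; q⊆p∪q; x∈p∩q⁻;
         x∈p∩q⁺; x∈∁p⇒x∉p; x∉∁p⇒x∈p; x∉p⇒x∈∁p; p⊂q⇒∣p∣<∣q∣; p⊂q⇒∁p⊃∁q)
open import Data.Integer.Base as ℤ using (ℤ; +_; -[1+_]; _⊖_)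
import Data.Integer.Properties as ℤ
open import Data.Maybe.Base using (Maybe; just; nothing)
open import Data.Nat.Base as ℕ using (zero; suc; s≤s; z≤n; s<s; s<s⁻¹; z<s)
open import Data.Nat.Induction using (<-wellFounded)
import Data.Nat.Properties as ℕ
open import Data.Product.Base using (∃-syntax; ∃₂; _×_; _,_; proj₁; proj₂)
open import Data.Sum.Base as Sum using (inj₁; inj₂; [_,_]′)
open import Data.Vec.Base using ([]; _∷_; tabulate)
import Data.Vec.Functional as F
open import Data.Vec.Properties using (lookup∘tabulate; lookup⇒[]=; []=⇒lookup)
open import Function.Base using (_∘_)
open import Induction.WellFounded using (Acc; acc)
open import Level using (_⊔_)
open import Relation.Binary.Core using (Rel)
open import Relation.Binary.Definitions using (tri<; tri≈; tri>)
open import Relation.Binary.PropositionalEquality as ≡ using (_≡_; _≢_)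
import Relation.Binary.Reasoning.Setoid as SetoidReasoning
open import Relation.Binary.Structures using (IsDecTotalOrder)
open import Relation.Nullary.Decidable
  using (Dec; yes; no; does; dec-true; dec-false; _×-dec_; _⊎-dec_; _→-dec_; ¬?; decidable-stable)
open import Relation.Nullary.Negation using (¬_; contradiction)
import Relation.Unary as U

-- A ring solver with integer coefficients.

module IntegerSolver {c ℓ} (R : CommutativeRing c ℓ) where
  open CommutativeRing R
  open RingProperties ring
  open Mult semiring using (1+×; ×-homo-+; ×1-homo-*) renaming (_×_ to _×ᴿ_)
  open SetoidReasoning setoid

  -- With this version of `×ᴿ`, `fromℤ (+ 1)` reduces to `1#`, so `con (+ 1)` denotes `1#`
  -- definitionally and `refl` can close solver goals that mention `1#`.
  fromℤ : ℤ → Carrier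
  fromℤ (+ n)    = n ×ᴿ 1#
  fromℤ -[1+ n ] = - (suc n ×ᴿ 1#)

  -‿homo : ∀ i → fromℤ (ℤ.- i) ≈ - fromℤ i
  -‿homo (+ zero)  = sym -0#≈0#
  -‿homo (+ suc n) = refl
  -‿homo -[1+ n ]  = sym (-‿involutive _)

  private
    cancel-1+ : ∀ x y z → (x + y) - (x + z) ≈ y - z
    cancel-1+ x y z = begin
      (x + y) - (x + z)      ≈⟨ +-cong (+-comm y x) (-‿+-comm x z) ⟨
      (y + x) + (- x - z)    ≈⟨ +-assoc y x _ ⟩
      y + (x + (- x - z))    ≈⟨ +-congˡ (+-assoc x (- x) (- z)) ⟨
      y + ((x - x) - z)      ≈⟨ +-congˡ (+-congʳ (-‿inverseʳ x)) ⟩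
      y + (0# - z)           ≈⟨ +-congˡ (+-identityˡ _) ⟩
      y - z                  ∎

  ⊖-homo : ∀ m n → fromℤ (m ⊖ n) ≈ m ×ᴿ 1# - n ×ᴿ 1#
  ⊖-homo m       zero    = begin
    fromℤ (m ⊖ 0)   ≡⟨⟩
    m ×ᴿ 1#          ≈⟨ +-identityʳ _ ⟨
    m ×ᴿ 1# + 0#     ≈⟨ +-congˡ -0#≈0# ⟨
    m ×ᴿ 1# - 0#     ∎
  ⊖-homo zero    (suc n) = sym (+-identityˡ _)
  ⊖-homo (suc m) (suc n) = begin
    fromℤ (suc m ⊖ suc n)            ≡⟨ ≡.cong fromℤ (ℤ.[1+m]⊖[1+n]≡m⊖n m n) ⟩
    fromℤ (m ⊖ n)                    ≈⟨ ⊖-homo m n ⟩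
    m ×ᴿ 1# - n ×ᴿ 1#                  ≈⟨ cancel-1+ 1# _ _ ⟨
    (1# + m ×ᴿ 1#) - (1# + n ×ᴿ 1#)    ≈⟨ +-cong (1+× m 1#) (-‿cong (1+× n 1#)) ⟨
    suc m ×ᴿ 1# - suc n ×ᴿ 1#          ∎

  +-homo : ∀ i j → fromℤ (i ℤ.+ j) ≈ fromℤ i + fromℤ j
  +-homo (+ m)    (+ n)    = ×-homo-+ 1# m n
  +-homo (+ m)    -[1+ n ] = ⊖-homo m (suc n)
  +-homo -[1+ m ] (+ n)    = trans (⊖-homo n (suc m)) (+-comm _ _)
  +-homo -[1+ m ] -[1+ n ] = begin
    - (suc (suc (m ℕ.+ n)) ×ᴿ 1#)      ≈⟨ -‿cong (1+× (suc (m ℕ.+ n)) 1#) ⟩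
    - (1# + (suc m ℕ.+ n) ×ᴿ 1#)       ≈⟨ -‿cong (+-congˡ (×-homo-+ 1# (suc m) n)) ⟩
    - (1# + (suc m ×ᴿ 1# + n ×ᴿ 1#))    ≈⟨ -‿cong (+-assoc _ _ _) ⟨
    - ((1# + suc m ×ᴿ 1#) + n ×ᴿ 1#)    ≈⟨ -‿cong (+-congʳ (+-comm _ _)) ⟩
    - ((suc m ×ᴿ 1# + 1#) + n ×ᴿ 1#)    ≈⟨ -‿cong (+-assoc _ _ _) ⟩
    - (suc m ×ᴿ 1# + (1# + n ×ᴿ 1#))    ≈⟨ -‿cong (+-congˡ (1+× n 1#)) ⟨
    - (suc m ×ᴿ 1# + suc n ×ᴿ 1#)       ≈⟨ -‿+-comm _ _ ⟨
    - (suc m ×ᴿ 1#) - suc n ×ᴿ 1#       ∎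

  private
    +*-homo : ∀ m j → fromℤ (+ m ℤ.* j) ≈ fromℤ (+ m) * fromℤ j
    +*-homo m (+ n)    = begin
      fromℤ (+ m ℤ.* + n)     ≡⟨ ≡.cong fromℤ (ℤ.pos-* m n) ⟨
      (m ℕ.* n) ×ᴿ 1#          ≈⟨ ×1-homo-* m n ⟩
      (m ×ᴿ 1#) * (n ×ᴿ 1#)     ∎
    +*-homo m -[1+ n ] = begin
      fromℤ (+ m ℤ.* -[1+ n ])           ≡⟨ ≡.cong fromℤ (ℤ.neg-distribʳ-* (+ m) (+ suc n)) ⟨
      fromℤ (ℤ.- (+ m ℤ.* + suc n))      ≈⟨ -‿homo (+ m ℤ.* + suc n) ⟩
      - fromℤ (+ m ℤ.* + suc n)          ≈⟨ -‿cong (+*-homo m (+ suc n)) ⟩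
      - (fromℤ (+ m) * fromℤ (+ suc n))  ≈⟨ -‿distribʳ-* _ _ ⟩
      fromℤ (+ m) * fromℤ -[1+ n ]       ∎

  *-homo : ∀ i j → fromℤ (i ℤ.* j) ≈ fromℤ i * fromℤ j
  *-homo (+ m)    j = +*-homo m j
  *-homo -[1+ m ] j = begin
    fromℤ (-[1+ m ] ℤ.* j)           ≡⟨ ≡.cong fromℤ (ℤ.neg-distribˡ-* (+ suc m) j) ⟨
    fromℤ (ℤ.- (+ suc m ℤ.* j))      ≈⟨ -‿homo (+ suc m ℤ.* j) ⟩
    - fromℤ (+ suc m ℤ.* j)          ≈⟨ -‿cong (+*-homo (suc m) j) ⟩
    - (fromℤ (+ suc m) * fromℤ j)    ≈⟨ -‿distribˡ-* _ _ ⟩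
    fromℤ -[1+ m ] * fromℤ j         ∎

  homomorphism : ℤ.+-*-rawRing -Raw-AlmostCommutative⟶ fromCommutativeRing R
  homomorphism = record
    { ⟦_⟧    = fromℤ
    ; +-homo = +-homo
    ; *-homo = *-homo
    ; -‿homo = -‿homo
    ; 0-homo = refl
    ; 1-homo = refl
    }

  fromℤ-≟ : ∀ i j → Maybe (fromℤ i ≈ fromℤ j)
  fromℤ-≟ i j with i ℤ.≟ j
  ... | yes ≡.refl = just refl
  ... | no _       = nothing

  open RingSolver ℤ.+-*-rawRing (fromCommutativeRing R) homomorphism fromℤ-≟ public
    using (Polynomial; solve; _:=_; _:+_; _:*_; _:-_; :-_; _:^_; con)

-- Determinants of order 2, 3 and 4 in terms of `s`.

module Minors {c ℓ₁ ℓ₂} (ℝ : CompleteOrderedField c ℓ₁ ℓ₂) where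
  open CompleteOrderedField ℝ hiding (zero; _≤_)
  open Matrices ℝ
  open IntegerSolver commutativeRing
  open Exp semiring using (_^_)
  open RingSum semiring using (sum-cong-≋)

  det-cong : ∀ {n} {M N : Matrix n} → M ≋ N → det M ≈ det N
  det-cong {zero}  M≋N = refl
  det-cong {suc n} M≋N = sum-cong-≋ λ j →
    *-congˡ {(- 1#) ^ toℕ j} (*-cong (M≋N zero j) (det-cong λ k l → M≋N (suc k) (punchIn j l)))

  -- For a closed size this evaluates to det by definition, so the ring solver applies to
  -- determinants without expanding them by hand.
  detᴾ : ∀ {m n} → F.Vector (F.Vector (Polynomial m) n) n → Polynomial m
  detᴾ {n = zero}  M = con (+ 1)
  detᴾ {n = suc n} M = F.foldr _:+_ (con (+ 0)) λ j →
    ((:- con (+ 1)) :^ toℕ j) :* (M zero j :* detᴾ (λ k l → M (suc k) (punchIn j l)))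

  -- Only the entries of `u` strictly above the diagonal are read. Recursion on both indices, in
  -- place of comparing them, lets the matrix compute at a closed size, and the generic `X` gives
  -- the same shape to polynomials and to field elements.
  fill : ∀ {a} {X : Set a} {n} → X → (X → X) → (X → X) → (Fin n → Fin n → X) → Fin n → Fin n → X
  fill o f g u zero    zero    = o
  fill o f g u zero    (suc j) = f (u zero (suc j))
  fill o f g u (suc i) zero    = g (u zero (suc i))
  fill o f g u (suc i) (suc j) = fill o f g (λ k l → u (suc k) (suc l)) i j

  skewᴾ : ∀ {m n} → Polynomial m → (Fin n → Fin n → Polynomial m) → Fin n → Fin n → Polynomial m
  skewᴾ h = fill (con (+ 0)) (λ x → h :* (con (+ 1) :+ x)) (λ x → h :* (con (+ 1) :- x))

  skew : ∀ {n} → Carrier → (Fin n → Fin n → Carrier) → Fin n → Fin n → Carrier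
  skew h = fill 0# (λ x → h * (1# + x)) (λ x → h * (1# - x))

  -- The first argument is a junk value for the positions that fill ignores.
  strictUpper : ∀ {a} {X : Set a} → X → (a b c d e f : X) → Fin 4 → Fin 4 → X
  strictUpper o a b c d e f 0F 1F = a
  strictUpper o a b c d e f 0F 2F = b
  strictUpper o a b c d e f 0F 3F = c
  strictUpper o a b c d e f 1F 2F = d
  strictUpper o a b c d e f 1F 3F = e
  strictUpper o a b c d e f 2F 3F = f
  strictUpper o a b c d e f _ _ = o

  -- xy + yz + zx along the 3-cycle i → j → k → i, in terms of s i j, s j k and s i k = − s k i.
  tri : Carrier → Carrier → Carrier → Carrier
  tri x y z = x * y - y * z - z * x

  triᴾ : ∀ {m} → Polynomial m → Polynomial m → Polynomial m → Polynomial m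
  triᴾ x y z = x :* y :- y :* z :- z :* x

  -- With `h` one half, this shows that the minors of order 2 determine the squares of `s`.
  det₂-skew : ∀ h (s : Fin 2 → Fin 2 → Carrier) →
              det (skew h s) ≈ (h * h) * (s 0F 1F * s 0F 1F - 1#)
  det₂-skew h s = solve 2 (λ h a →
    detᴾ (skewᴾ {n = 2} h (λ _ _ → a)) := (h :* h) :* (a :* a :- con (+ 1))) refl h (s 0F 1F)

  -- The determinant is the sum of the products along the two orientations of the 3-cycle. These are
  -- exchanged by negating `s`, so the terms of odd degree cancel.
  det₃-skew : ∀ h (s : Fin 3 → Fin 3 → Carrier) →
              det (skew h s) ≈
              (h * h * h) * ((1# + 1#) * (1# + tri (s 0F 1F) (s 1F 2F) (s 0F 2F)))
  det₃-skew h s = solve 4 (λ h a b d → let i = con (+ 1) in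
    -- Three indices are embedded in four in order to reuse `strictUpper`; the slots that involve
    -- the index 3 hold fillers.
    detᴾ (skewᴾ h λ k l → strictUpper i a b i d i i (Fin.inject₁ k) (Fin.inject₁ l)) :=
    (h :* h :* h) :* ((i :+ i) :* (i :+ triᴾ a d b)))
    refl h (s 0F 1F) (s 0F 2F) (s 1F 2F)

  -- Transposition negates `s`, so only even degrees survive. The part of degree 4 is the square of
  -- the Pfaffian `p`; the rest depends only on the squares and on the four triangles, which the
  -- orders 2 and 3 control.
  det₄-skew : ∀ h (s : Fin 4 → Fin 4 → Carrier) →
    let a = s 0F 1F; b = s 0F 2F; c = s 0F 3F; d = s 1F 2F; e = s 1F 3F; f = s 2F 3F
        p = a * f - b * e + c * d
    in det (skew h s) ≈
       (h * h * h * h) * (p * p -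
         ((1# + 1# + 1#) + (a * a + b * b + c * c + d * d + e * e + f * f)
          + (1# + 1#) * (tri a d b + tri a e c + tri b f c + tri d f e)))
  det₄-skew h s = solve 7 (λ h a b c d e f →
    let i = con (+ 1)
        p = a :* f :- b :* e :+ c :* d
    in detᴾ (skewᴾ h (strictUpper i a b c d e f)) :=
       (h :* h :* h :* h) :* (p :* p :-
         ((i :+ i :+ i) :+ (a :* a :+ b :* b :+ c :* c :+ d :* d :+ e :* e :+ f :* f)
          :+ (i :+ i) :* (triᴾ a d b :+ triᴾ a e c :+ triᴾ b f c :+ triᴾ d f e))))
    refl h (s 0F 1F) (s 0F 2F) (s 0F 3F) (s 1F 2F) (s 1F 3F) (s 2F 3F)

-- Decidable subsets and separated parts of a graph.

module _ {n p} {Q : U.Pred (Fin n) p} (Q? : U.Decidable Q) where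

  ⟪_⟫ : Subset n
  ⟪_⟫ = tabulate (does ∘ Q?)

  ∈⟪⟫⁺ : ∀ {x} → Q x → x ∈ ⟪_⟫
  ∈⟪⟫⁺ {x} q = lookup⇒[]= x _ (≡.trans (lookup∘tabulate _ x) (dec-true (Q? x) q))

  ∈⟪⟫⁻ : ∀ {x} → x ∈ ⟪_⟫ → Q x
  ∈⟪⟫⁻ {x} x∈ with Q? x | ≡.trans (≡.sym (lookup∘tabulate (does ∘ Q?) x)) ([]=⇒lookup x∈)
  ... | yes q | _ = q
  ... | no _  | ()

-- For symmetric `R` these are the unions of components of the graph induced on `U`, described
-- without paths.
record Separated {n ℓ} (R : Rel (Fin n) ℓ) (U X : Subset n) : Set ℓ where
  field
    ⊆U     : X ⊆ U
    noEdge : ∀ {x y} → x ∈ X → y ∈ U → y ∉ X → ¬ R x y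

-- The explicit witnesses make the negation the usual connectedness, so that neither paths nor
-- components have to be constructed.
record Disconnected {n ℓ} (R : Rel (Fin n) ℓ) (U : Subset n) : Set ℓ where
  field
    part      : Subset n
    separated : Separated R U part
    {x₀ y₀}   : Fin n
    x₀∈part   : x₀ ∈ part
    y₀∈U      : y₀ ∈ U
    y₀∉part   : y₀ ∉ part

infixl 6 _∖_

_∖_ : ∀ {n} → Subset n → Subset n → Subset n
U ∖ X = U ∩ ∁ X

module _ {n} {U X : Subset n} where
  ∈∖⁺ : ∀ {x} → x ∈ U → x ∉ X → x ∈ U ∖ X
  ∈∖⁺ x∈U x∉X = x∈p∩q⁺ (x∈U , x∉p⇒x∈∁p x∉X)

  ∈∖⁻ : ∀ {x} → x ∈ U ∖ X → x ∈ U × x ∉ X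
  ∈∖⁻ x∈ = let x∈U , x∈∁X = x∈p∩q⁻ U (∁ X) x∈ in x∈U , x∈∁p⇒x∉p x∈∁X

  ∉∖ : ∀ {x} → x ∈ X → x ∉ U ∖ X
  ∉∖ x∈X x∈ = proj₂ (∈∖⁻ x∈) x∈X

  ∖-separated : ∀ {ℓ} {R : Rel (Fin n) ℓ} → (∀ {x y} → R x y → R y x) →
                Separated R U X → Separated R U (U ∖ X)
  ∖-separated R-sym sep = record
    { ⊆U     = proj₁ ∘ ∈∖⁻
    ; noEdge = λ {x} {y} x∈ y∈U y∉ Rxy →
        Separated.noEdge sep (decidable-stable (y ∈? X) (y∉ ∘ ∈∖⁺ y∈U))
          (proj₁ (∈∖⁻ x∈)) (proj₂ (∈∖⁻ x∈)) (R-sym Rxy)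
    }

-- Field facts: no zero divisors, and 2 is non-zero.

module Field {c ℓ₁ ℓ₂} (ℝ : CompleteOrderedField c ℓ₁ ℓ₂) where
  open CompleteOrderedField ℝ hiding (zero) renaming (_≤_ to _≤ᴿ_)
  open RingProperties ring
  open IntegerSolver commutativeRing
  open SetoidReasoning setoid
  private module ≤ = IsDecTotalOrder isDecTotalOrder
  open ≤ public using (_≟_)

  0≤1 : 0# ≤ᴿ 1#
  0≤1 with ≤.total 0# 1#
  ... | inj₁ 0≤1 = 0≤1
  ... | inj₂ 1≤0 = ≤.≤-respʳ-≈ (solve 0 ((:- con (+ 1)) :* (:- con (+ 1)) := con (+ 1)) refl)
                     (*-nonNeg 0≤-1 0≤-1)
    where
    0≤-1 : 0# ≤ᴿ - 1#
    0≤-1 = ≤.≤-respˡ-≈ (-‿inverseʳ 1#) (≤.≤-respʳ-≈ (+-identityˡ _) (+-monoˡ-≤ (- 1#) 1≤0))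

  2≉0 : ¬ (1# + 1# ≈ 0#)
  2≉0 2≈0 = 0≉1 (≤.antisym 0≤1
    (≤.≤-respʳ-≈ 2≈0 (≤.≤-respˡ-≈ (+-identityˡ 1#) (+-monoˡ-≤ 1# 0≤1))))

  zero-product : ∀ {x y} → x * y ≈ 0# → ¬ (x ≈ 0#) → y ≈ 0#
  zero-product {x} {y} xy≈0 x≉0 with inverse x x≉0
  ... | z , xz≈1 = begin
    y              ≈⟨ *-identityˡ y ⟨
    1# * y         ≈⟨ *-congʳ (trans (*-comm z x) xz≈1) ⟨
    (z * x) * y    ≈⟨ *-assoc z x y ⟩
    z * (x * y)    ≈⟨ *-congˡ xy≈0 ⟩
    z * 0#         ≈⟨ zeroʳ z ⟩
    0#             ∎

  x+x≈0⇒x≈0 : ∀ {x} → x + x ≈ 0# → x ≈ 0#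
  x+x≈0⇒x≈0 {x} x+x≈0 = zero-product
    (trans (distribʳ x 1# 1#) (trans (+-cong (*-identityˡ x) (*-identityˡ x)) x+x≈0)) 2≉0

  x≉-x : ∀ {x} → ¬ (x ≈ 0#) → ¬ (x ≈ - x)
  x≉-x {x} x≉0 x≈-x = x≉0 (x+x≈0⇒x≈0 (trans (+-congˡ x≈-x) (-‿inverseʳ x)))

-- Two-colourings of pairs.

module Core {c ℓ₁ ℓ₂} (ℝ : CompleteOrderedField c ℓ₁ ℓ₂) where
  open CompleteOrderedField ℝ hiding (zero; _≤_)
  open RingProperties ring using (-‿involutive)
  open Field ℝ

  -- The Pfaffian condition on four vertices where `P` is the path `v p q r` and `R` the
  -- complementary path `q v r p`, each path carrying a single value up to orientation.
  Quad : ∀ {n ℓ} → (Fin n → Fin n → Carrier) → Rel (Fin n) ℓ → Rel (Fin n) ℓ → Set (c ⊔ ℓ₁ ⊔ ℓ)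
  Quad s P R = ∀ {v p q r t w} → P v p → P p q → P q r → R v q → R v r → R p r →
    s p v ≈ t → s p q ≈ t → s r q ≈ t → s v r ≈ w → s v q ≈ w → s p r ≈ w →
    (w ≈ t) ⊎ (w ≈ - t)

  -- P and R stand for the preserved and the reversed pairs; the axioms are symmetric in P and R,
  -- which interchanges B and its transpose.
  record Colouring {n ℓ} (s : Fin n → Fin n → Carrier) (P R : Rel (Fin n) ℓ) :
                   Set (c ⊔ ℓ₁ ⊔ ℓ) where
    field
      s-skew   : ∀ x y → s y x ≈ - s x y
      P?       : ∀ x y → Dec (P x y)
      R?       : ∀ x y → Dec (R x y)
      P-sym    : ∀ {x y} → P x y → P y x
      R-sym    : ∀ {x y} → R x y → R y x
      P-nz     : ∀ {x y} → P x y → ¬ (s x y ≈ 0#)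
      R-nz     : ∀ {x y} → R x y → ¬ (s x y ≈ 0#)
      disjoint : ∀ {x y} → P x y → ¬ R x y
      colour   : ∀ x y → s x y ≈ 0# ⊎ (P x y ⊎ R x y)
      mixed    : ∀ {a b c} → P a b → R b c →
                 (P a c × s a b ≈ s a c) ⊎ (R a c × s a c ≈ s b c)
      quadᴾ    : Quad s P R
      quadᴿ    : Quad s R P

    flip : ∀ {x y a} → s x y ≈ a → s y x ≈ - a
    flip {x} {y} e = trans (s-skew x y) (-‿cong e)

    flip⁻ : ∀ {x y a} → s x y ≈ - a → s y x ≈ a
    flip⁻ e = trans (flip e) (-‿involutive _)

    flip₂ : ∀ {x y z t} → s x y ≈ s z t → s y x ≈ s t z
    flip₂ e = trans (flip e) (sym (s-skew _ _))

  swap : ∀ {n ℓ} {s : Fin n → Fin n → Carrier} {P R : Rel (Fin n) ℓ} →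
         Colouring s P R → Colouring s R P
  swap C = record
    { s-skew   = s-skew
    ; P?       = R?
    ; R?       = P?
    ; P-sym    = R-sym
    ; R-sym    = P-sym
    ; P-nz     = R-nz
    ; R-nz     = P-nz
    ; disjoint = λ r p → disjoint p r
    ; colour   = λ x y → Sum.map₂ Sum.swap (colour x y)
    ; mixed    = λ Rab Pbc → Sum.swap (Sum.map
        (λ (Pca , e) → P-sym Pca , flip₂ (sym e))
        (λ (Rca , e) → R-sym Rca , flip₂ (sym e)) (mixed (P-sym Pbc) (R-sym Rab)))
    ; quadᴾ    = quadᴿ
    ; quadᴿ    = quadᴾ
    }
    where open Colouring C

  -- The constant cut built around a minimal separated part.

  module Cut {n ℓ} {s : Fin n → Fin n → Carrier} {P R : Rel (Fin n) ℓ} (C : Colouring s P R)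
    {U F : Subset n} (F-sep : Separated R U F)
    {p₀ q₀ v₀ : Fin n} (p₀∈F : p₀ ∈ F) (q₀∈U : q₀ ∈ U) (q₀∉F : q₀ ∉ F) (v₀∉U : v₀ ∉ U)
    (Pp₀v₀ : P p₀ v₀)
    -- The next two hypotheses are what the maximality of `U` provides; the last one makes `F`
    -- minimal among the separated parts that contain `p₀`.
    (meetsᴾ : ∀ {v} → v ∉ U → ∃[ p ] p ∈ U × P v p)
    (meetsᴿ : ∀ {v X x y} → v ∉ U → Separated R U X → x ∈ X → y ∈ U → y ∉ X →
              ∃[ r ] r ∈ X × R v r)
    (minimal : ∀ {G f} → Separated R U G → G ⊆ F → p₀ ∈ G → f ∈ F → ¬ f ∉ G)
    where
    open Colouring C
    open Colouring (swap C) using () renaming (mixed to mixed′)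
    open Separated F-sep using () renaming (⊆U to F⊆U; noEdge to F-noEdge)

    u : Carrier
    u = s p₀ v₀

    u≉-u : ¬ (u ≈ - u)
    u≉-u = x≉-x (P-nz Pp₀v₀)

    Target : Fin n → Fin n → Set (ℓ₁ ⊔ ℓ)
    Target x y = P x y × s x y ≈ u

    target? : ∀ x y → Dec (Target x y)
    target? x y = P? x y ×-dec (s x y ≟ u)

    -- The vertices `q` that fail form a set `G` that is again separated: along an R-edge between
    -- failing and non-failing vertices, the triangle with `p₀` would transfer the value. Hence `v₀`
    -- has an R-edge to some `r` in `G`, and the triangle `p₀ v₀ r` shows that `r` does not fail.
    p₀→rest : ∀ {q} → q ∈ U → q ∉ F → Target p₀ q
    p₀→rest {q} q∈U q∉F = decidable-stable (target? p₀ q) λ ¬t →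
      let r , r∈G , Rv₀r = meetsᴿ v₀∉U G-sep (∈⟪⟫⁺ G? (q∈U , q∉F , ¬t)) (F⊆U p₀∈F)
                             (λ p₀∈G → proj₁ (proj₂ (∈⟪⟫⁻ G? p₀∈G)) p₀∈F)
          r∈U , r∉F , ¬tr = ∈⟪⟫⁻ G? r∈G
      in [ (λ (Pp₀r , e) → ¬tr (Pp₀r , sym e))
         , (λ (Rp₀r , _) → F-noEdge p₀∈F r∈U r∉F Rp₀r) ]′ (mixed Pp₀v₀ Rv₀r)
      where
      G? : U.Decidable (λ q → q ∈ U × q ∉ F × ¬ Target p₀ q)
      G? q = (q ∈? U) ×-dec (¬? (q ∈? F) ×-dec ¬? (target? p₀ q))

      G-noEdge : ∀ {x y} → x ∈ ⟪ G? ⟫ → y ∈ U → y ∉ ⟪ G? ⟫ → ¬ R x y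
      G-noEdge {x} {y} x∈G y∈U y∉G Rxy with ∈⟪⟫⁻ G? x∈G | y ∈? F | target? p₀ y
      ... | x∈U , x∉F , ¬t | yes y∈F | _           = F-noEdge y∈F x∈U x∉F (R-sym Rxy)
      ... | x∈U , x∉F , ¬t | no y∉F  | no ¬t′      = y∉G (∈⟪⟫⁺ G? (y∈U , y∉F , ¬t′))
      ... | x∈U , x∉F , ¬t | no y∉F  | yes (Py , e) with mixed Py (R-sym Rxy)
      ...   | inj₁ (Px , e′) = ¬t (Px , trans (sym e′) e)
      ...   | inj₂ (Rx , _)  = F-noEdge p₀∈F x∈U x∉F Rx

      G-sep : Separated R U ⟪ G? ⟫
      G-sep = record { ⊆U = proj₁ ∘ ∈⟪⟫⁻ G? ; noEdge = G-noEdge }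

    -- For fixed `q`, the vertices of `F` that satisfy the claim form a separated set containing
    -- `p₀`, so by minimality they are all of `F`.
    F→rest : ∀ {f q} → f ∈ F → q ∈ U → q ∉ F → Target f q
    F→rest {f} {q} f∈F q∈U q∉F = decidable-stable (target? f q) λ ¬t →
      minimal G-sep (proj₁ ∘ ∈⟪⟫⁻ G?) (∈⟪⟫⁺ G? (p₀∈F , p₀→rest q∈U q∉F)) f∈F
        (¬t ∘ proj₂ ∘ ∈⟪⟫⁻ G?)
      where
      G? : U.Decidable (λ g → g ∈ F × Target g q)
      G? g = (g ∈? F) ×-dec target? g q

      G-noEdge : ∀ {x y} → x ∈ ⟪ G? ⟫ → y ∈ U → y ∉ ⟪ G? ⟫ → ¬ R x y
      G-noEdge {x} {y} x∈G y∈U y∉G Rxy with ∈⟪⟫⁻ G? x∈G | y ∈? F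
      ... | x∈F , _      | no y∉F  = F-noEdge x∈F y∈U y∉F Rxy
      ... | x∈F , Px , e | yes y∈F with mixed′ (R-sym Rxy) Px
      ...   | inj₁ (Ry , _)  = F-noEdge y∈F q∈U q∉F Ry
      ...   | inj₂ (Py , e′) = y∉G (∈⟪⟫⁺ G? (y∈F , Py , trans e′ e))

      G-sep : Separated R U ⟪ G? ⟫
      G-sep = record { ⊆U = F⊆U ∘ proj₁ ∘ ∈⟪⟫⁻ G? ; noEdge = G-noEdge }

    rest-sep : Separated R U (U ∖ F)
    rest-sep = ∖-separated R-sym F-sep

    -- The order 3 condition in the case of two R-edges; the other alternative of `mixed` would give
    -- `p r` both colours.
    lone : ∀ {v p r} → P v p → R v r → R p r → s p r ≈ s v r
    lone Pvp Rvr Rpr with mixed (P-sym Pvp) Rvr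
    ... | inj₁ (Ppr , _) = contradiction Rpr (disjoint Ppr)
    ... | inj₂ (_ , e)   = e

    -- The edges from an outside vertex to the two sides of `U`.

    module _ {v} (v∉U : v ∉ U) where

      private
        inF : ∃[ r ] r ∈ F × R v r
        inF = meetsᴿ v∉U F-sep p₀∈F q₀∈U q₀∉F

        inRest : ∃[ r ] r ∈ U ∖ F × R v r
        inRest = meetsᴿ v∉U rest-sep (∈∖⁺ q₀∈U q₀∉F) (F⊆U p₀∈F) (∉∖ p₀∈F)

      rᶠ rᵍ : Fin n
      rᶠ = proj₁ inF
      rᵍ = proj₁ inRest

      rᶠ∈F : rᶠ ∈ F
      rᶠ∈F = proj₁ (proj₂ inF)

      Rvrᶠ : R v rᶠ
      Rvrᶠ = proj₂ (proj₂ inF)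

      rᵍ∈U : rᵍ ∈ U
      rᵍ∈U = proj₁ (∈∖⁻ (proj₁ (proj₂ inRest)))

      rᵍ∉F : rᵍ ∉ F
      rᵍ∉F = proj₂ (∈∖⁻ (proj₁ (proj₂ inRest)))

      Rvrᵍ : R v rᵍ
      Rvrᵍ = proj₂ (proj₂ inRest)

      w : Carrier
      w = s v rᵍ

      -- In the triangle `x rᵍ v`, the edge `x rᵍ` is in `P` with value `u` and `rᵍ v` is in `R`.
      sidesF : ∀ {x} → x ∈ F → (P v x × s x v ≈ u) ⊎ (R v x × s v x ≈ w)
      sidesF x∈F =
        let Pxr , xr≈u = F→rest x∈F rᵍ∈U rᵍ∉F
        in Sum.map (λ (Pxv , e) → P-sym Pxv , trans (sym e) xr≈u)
                   (λ (Rxv , e) → R-sym Rxv , flip₂ e) (mixed Pxr (R-sym Rvrᵍ))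

      rᶠ≈w : s v rᶠ ≈ w
      rᶠ≈w = [ (λ (Pvr , _) → contradiction Rvrᶠ (disjoint Pvr)) , proj₂ ]′ (sidesF rᶠ∈F)

      -- The same argument with the triangle `x rᶠ v`; `rᶠ≈w` carries the value `w` over from the
      -- other side.
      sidesRest : ∀ {x} → x ∈ U → x ∉ F → (P v x × s v x ≈ u) ⊎ (R v x × s v x ≈ w)
      sidesRest x∈U x∉F =
        let Prx , rx≈u = F→rest rᶠ∈F x∈U x∉F
        in Sum.map (λ (Pxv , e) → P-sym Pxv , trans (sym (flip₂ e)) rx≈u)
                   (λ (Rxv , e) → R-sym Rxv , trans (flip₂ e) rᶠ≈w)
                   (mixed (P-sym Prx) (R-sym Rvrᶠ))

      PorR : ∀ {x} → x ∈ U → P v x ⊎ R v x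
      PorR {x} x∈U with x ∈? F
      ... | yes x∈F = Sum.map proj₁ proj₁ (sidesF x∈F)
      ... | no x∉F  = Sum.map proj₁ proj₁ (sidesRest x∈U x∉F)

      P-F : ∀ {x} → x ∈ F → P v x → s x v ≈ u
      P-F x∈F Pvx = [ proj₂ , (λ (Rvx , _) → contradiction Rvx (disjoint Pvx)) ]′ (sidesF x∈F)

      P-rest : ∀ {x} → x ∈ U → x ∉ F → P v x → s v x ≈ u
      P-rest x∈U x∉F Pvx =
        [ proj₂ , (λ (Rvx , _) → contradiction Rvx (disjoint Pvx)) ]′ (sidesRest x∈U x∉F)

      R-w : ∀ {x} → x ∈ U → R v x → s v x ≈ w
      R-w {x} x∈U Rvx with x ∈? F
      ... | yes x∈F = [ (λ (Pvx , _) → contradiction Rvx (disjoint Pvx)) , proj₂ ]′ (sidesF x∈F)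
      ... | no x∉F  =
        [ (λ (Pvx , _) → contradiction Rvx (disjoint Pvx)) , proj₂ ]′ (sidesRest x∈U x∉F)

      -- Otherwise no R-edge joins the P-neighbours of `v` in `H` to its R-neighbours there. The
      -- P-neighbours would then form a separated set, to which `v` must have an R-edge, although
      -- all its edges there are in `P`.
      adjacent : ∀ {H p y} → Separated R U H → p ∈ H → P v p → y ∈ U → y ∉ H →
                 ∃₂ λ p r → p ∈ H × r ∈ H × P v p × R v r × R p r
      adjacent {H} {p} H-sep p∈H Pvp y∈U y∉H
        with any? (λ p → any? λ r →
               (p ∈? H) ×-dec ((r ∈? H) ×-dec (P? v p ×-dec (R? v r ×-dec R? p r))))
      ... | yes found = found
      ... | no none   =
        let r , r∈G , Rvr = meetsᴿ v∉U G-sep (∈⟪⟫⁺ G? (p∈H , Pvp)) y∈U (y∉H ∘ proj₁ ∘ ∈⟪⟫⁻ G?)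
        in contradiction Rvr (disjoint (proj₂ (∈⟪⟫⁻ G? r∈G)))
        where
        G? : U.Decidable (λ x → x ∈ H × P v x)
        G? x = (x ∈? H) ×-dec P? v x

        G-noEdge : ∀ {x y} → x ∈ ⟪ G? ⟫ → y ∈ U → y ∉ ⟪ G? ⟫ → ¬ R x y
        G-noEdge {x} {y} x∈G y∈U y∉G Rxy with ∈⟪⟫⁻ G? x∈G | y ∈? H | PorR y∈U
        ... | x∈H , _   | no y∉H  | _        = Separated.noEdge H-sep x∈H y∈U y∉H Rxy
        ... | x∈H , Pvx | yes y∈H | inj₁ Pvy = y∉G (∈⟪⟫⁺ G? (y∈H , Pvy))
        ... | x∈H , Pvx | yes y∈H | inj₂ Rvy = none (x , y , x∈H , y∈H , Pvx , Rvy , Rxy)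

        G-sep : Separated R U ⟪ G? ⟫
        G-sep = record { ⊆U = Separated.⊆U H-sep ∘ proj₁ ∘ ∈⟪⟫⁻ G? ; noEdge = G-noEdge }

      adjacentF : ∀ {p} → p ∈ F → P v p → ∃₂ λ p r → p ∈ F × r ∈ F × P v p × R v r × R p r
      adjacentF p∈F Pvp = adjacent F-sep p∈F Pvp q₀∈U q₀∉F

      adjacentRest : ∀ {p} → p ∈ U → p ∉ F → P v p →
                     ∃₂ λ p r → p ∈ U ∖ F × r ∈ U ∖ F × P v p × R v r × R p r
      adjacentRest p∈U p∉F Pvp =
        adjacent rest-sep (∈∖⁺ p∈U p∉F) Pvp (F⊆U p₀∈F) (∉∖ p₀∈F)

      -- `adjacent`, on the side of `U` where `v` has a P-neighbour, gives `p` and `r`; with the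
      -- R-neighbour of `v` on the other side as `q`, they form the configuration of `Quad`.
      w≈±u : w ≈ u ⊎ w ≈ - u
      w≈±u with meetsᴾ v∉U
      ... | p , p∈U , Pvp with p ∈? F
      ...   | yes p∈F =
        let p , r , p∈F , r∈F , Pvp , Rvr , Rpr = adjacentF p∈F Pvp
            Ppq , pq≈u = F→rest p∈F rᵍ∈U rᵍ∉F
            Prq , rq≈u = F→rest r∈F rᵍ∈U rᵍ∉F
            vr≈w = R-w (F⊆U r∈F) Rvr
        in quadᴾ Pvp Ppq (P-sym Prq) Rvrᵍ Rvr Rpr
             (P-F p∈F Pvp) pq≈u rq≈u vr≈w refl (trans (lone Pvp Rvr Rpr) vr≈w)
      ...   | no p∉F =
        let p , r , p∈ , r∈ , Pvp , Rvr , Rpr = adjacentRest p∈U p∉F Pvp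
            p∈U , p∉F = ∈∖⁻ p∈
            r∈U , r∉F = ∈∖⁻ r∈
            Pqp , qp≈u = F→rest rᶠ∈F p∈U p∉F
            Pqr , qr≈u = F→rest rᶠ∈F r∈U r∉F
            vr≈w = R-w r∈U Rvr
        -- The edges between `F` and the rest are now read backwards, so `quadᴾ` applies with `- u`
        -- and its two alternatives change places.
        in Sum.swap (Sum.map₂ (λ e → trans e (-‿involutive u))
             (quadᴾ Pvp (P-sym Pqp) Pqr Rvrᶠ Rvr Rpr (flip (P-rest p∈U p∉F Pvp))
               (flip qp≈u) (flip qr≈u) vr≈w rᶠ≈w (trans (lone Pvp Rvr Rpr) vr≈w)))

    -- Vertices above and below, and the resulting cut.

    Above Below : Fin n → Set (ℓ₁ ⊔ ℓ)
    Above v = ∀ x → x ∈ U → R v x → s v x ≈ u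
    Below v = ∀ x → x ∈ U → R v x → s x v ≈ u

    above? : U.Decidable Above
    above? v = all? λ x → (x ∈? U) →-dec (R? v x →-dec (s v x ≟ u))

    above⊎below : ∀ {v} → v ∉ U → Above v ⊎ Below v
    above⊎below v∉U with w≈±u v∉U
    ... | inj₁ w≈u  = inj₁ λ x x∈U Rvx → trans (R-w v∉U x∈U Rvx) w≈u
    ... | inj₂ w≈-u = inj₂ λ x x∈U Rvx → flip⁻ (trans (R-w v∉U x∈U Rvx) w≈-u)

    above→rest : ∀ {v x} → v ∉ U → Above v → x ∈ U → x ∉ F → s v x ≈ u
    above→rest v∉U above x∈U x∉F with PorR v∉U x∈U
    ... | inj₁ Pvx = P-rest v∉U x∈U x∉F Pvx
    ... | inj₂ Rvx = above _ x∈U Rvx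

    F→below : ∀ {v x} → v ∉ U → Below v → x ∈ F → s x v ≈ u
    F→below v∉U below x∈F with PorR v∉U (F⊆U x∈F)
    ... | inj₁ Pvx = P-F v∉U x∈F Pvx
    ... | inj₂ Rvx = below _ (F⊆U x∈F) Rvx

    contra± : ∀ {x y z t} → s x y ≈ u → s z t ≈ - u → ¬ (s x y ≈ s z t)
    contra± e e′ e″ = u≉-u (trans (sym e) (trans e″ e′))

    via : ∀ {a b c} → s a b ≈ u → s b c ≈ u → P a b → R b c → s a c ≈ u
    via ab bc Pab Rbc with mixed Pab Rbc
    ... | inj₁ (_ , e) = trans (sym e) ab
    ... | inj₂ (_ , e) = trans e bc

    via′ : ∀ {a b c} → s a b ≈ u → s b c ≈ u → R a b → P b c → s a c ≈ u
    via′ ab bc Rab Pbc with mixed′ Rab Pbc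
    ... | inj₁ (_ , e) = trans (sym e) ab
    ... | inj₂ (_ , e) = trans e bc

    module _ {a b} (a∉U : a ∉ U) (b∉U : b ∉ U) (above : Above a) (below : Below b) where

      -- An R-edge `p r` in `F` with `a p` in `P` and `a r` in `R` is compared with `b`. If `b r` is
      -- in `P`, the path `a r b` gives the value; otherwise `b p` must be in `R`, and the triangle
      -- `a p b` gives it.
      above→below-F : ∀ {p} → p ∈ F → P a p → s a b ≈ u
      above→below-F p∈F Pap with adjacentF a∉U p∈F Pap
      ... | p , r , p∈F , r∈F , Pap , Rar , Rpr
        with PorR b∉U (F⊆U r∈F) | PorR b∉U (F⊆U p∈F)
      ... | inj₁ Pbr | _ = via′ ar rb Rar (P-sym Pbr)
        where
        ar = above _ (F⊆U r∈F) Rar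
        rb = F→below b∉U below r∈F
      ... | inj₂ Rbr | inj₁ Pbp =
        contradiction (lone Pbp Rbr Rpr) (contra± pr (flip (F→below b∉U below r∈F)))
        where pr = trans (lone Pap Rar Rpr) (above _ (F⊆U r∈F) Rar)
      ... | inj₂ Rbr | inj₂ Rbp with mixed Pap (R-sym Rbp)
      ...   | inj₂ (_ , e) = trans e (F→below b∉U below p∈F)
      -- If `a b` were in `P`, the triangle `b a r` would either put `b r` in both colours or equate
      -- `s b r`, which is `- u`, with `s a r`, which is `u`.
      ...   | inj₁ (Pab , _) with mixed (P-sym Pab) Rar
      ...     | inj₁ (Pbr , _) = contradiction Rbr (disjoint Pbr)
      ...     | inj₂ (_ , e)   = contradiction (sym e)
                (contra± (above _ (F⊆U r∈F) Rar) (flip (F→below b∉U below r∈F)))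

      -- The mirror image of `above→below-F`: the R-edge `p r` is taken in the rest of `U` and
      -- adapted to `b`, then compared with `a`.
      above→below-rest : ∀ {p} → p ∈ U → p ∉ F → P b p → s a b ≈ u
      above→below-rest p∈U p∉F Pbp with adjacentRest b∉U p∈U p∉F Pbp
      ... | p , r , p∈ , r∈ , Pbp , Rbr , Rpr
        with ∈∖⁻ p∈ | ∈∖⁻ r∈
      ... | p∈U , p∉F | r∈U , r∉F with PorR a∉U r∈U | PorR a∉U p∈U
      ... | inj₁ Par | _ = via (above→rest a∉U above r∈U r∉F) (below _ r∈U Rbr) Par (R-sym Rbr)
      ... | inj₂ Rar | inj₁ Pap =
        contradiction (sym (lone Pap Rar Rpr)) (contra± (above _ r∈U Rar) pr)
        where pr = trans (lone Pbp Rbr Rpr) (flip (below _ r∈U Rbr))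
      ... | inj₂ Rar | inj₂ Rap with mixed′ Rap (P-sym Pbp)
      ...   | inj₁ (_ , e) = trans (sym e) (above _ p∈U Rap)
      ...   | inj₂ (Pab , _) with mixed (P-sym Pab) Rar
      ...     | inj₁ (Pbr , _) = contradiction Rbr (disjoint Pbr)
      ...     | inj₂ (_ , e)   = contradiction (sym e)
                (contra± (above _ r∈U Rar) (flip (below _ r∈U Rbr)))

      -- A P-neighbour of `a` in `U` selects the case. If it lies outside `F` and is an R-neighbour
      -- of `b`, the two-coloured path through it already suffices.
      above→below : s a b ≈ u
      above→below with meetsᴾ a∉U
      ... | p , p∈U , Pap with p ∈? F
      ...   | yes p∈F = above→below-F p∈F Pap
      ...   | no p∉F with PorR b∉U p∈U
      ...     | inj₁ Pbp = above→below-rest p∈U p∉F Pbp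
      ...     | inj₂ Rbp =
                via (above→rest a∉U above p∈U p∉F) (below _ p∈U Rbp) Pap (R-sym Rbp)

    Upper? : U.Decidable (λ x → x ∈ F ⊎ (x ∉ U × Above x))
    Upper? x = (x ∈? F) ⊎-dec (¬? (x ∈? U) ×-dec above? x)

    upper : Subset n
    upper = ⟪ Upper? ⟫

    p₀∈upper : p₀ ∈ upper
    p₀∈upper = ∈⟪⟫⁺ Upper? (inj₁ p₀∈F)

    q₀∉upper : q₀ ∉ upper
    q₀∉upper q₀∈ with ∈⟪⟫⁻ Upper? q₀∈
    ... | inj₁ q₀∈F       = q₀∉F q₀∈F
    ... | inj₂ (q₀∉U , _) = q₀∉U q₀∈U

    -- An outside vertex that is not above is below, so each case is one of `F→rest`, `above→rest`,
    -- `F→below` and `above→below`.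
    upper-cut : ∀ {x y} → x ∈ upper → y ∉ upper → s x y ≈ u
    upper-cut {x} {y} x∈ y∉ with ∈⟪⟫⁻ Upper? x∈ | y ∈? U
    ... | inj₁ x∈F             | yes y∈U = proj₂ (F→rest x∈F y∈U (y∉ ∘ ∈⟪⟫⁺ Upper? ∘ inj₁))
    ... | inj₂ (x∉U , above)   | yes y∈U = above→rest x∉U above y∈U (y∉ ∘ ∈⟪⟫⁺ Upper? ∘ inj₁)
    ... | x∈F⊎above | no y∉U with above⊎below y∉U
    ...   | inj₁ above = contradiction (∈⟪⟫⁺ Upper? (inj₂ (y∉U , above))) y∉
    upper-cut x∈ y∉ | inj₁ x∈F           | no y∉U | inj₂ below = F→below y∉U below x∈F
    upper-cut x∈ y∉ | inj₂ (x∉U , above) | no y∉U | inj₂ below = above→below x∉U y∉U above below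

-- Connectedness of both colour graphs on every vertex set.

module Connectivity {c ℓ₁ ℓ₂} (ℝ : CompleteOrderedField c ℓ₁ ℓ₂) {n}
  {s : Fin n → Fin n → CompleteOrderedField.Carrier ℝ} where
  open CompleteOrderedField ℝ hiding (zero; _≤_)
  open Field ℝ
  open Core ℝ

  -- The clan condition in terms of `s`; one direction is enough because `s` is skew.
  IsUniform : Subset n → Set ℓ₁
  IsUniform X = ∀ i j k → i ∈ X → j ∈ X → k ∉ X → s i k ≈ s j k

  -- Indecomposability in refutation form: `a ≢ b` rules out the empty set and the singletons, and
  -- `k` rules out the full set.
  NoClan : Set ℓ₁
  NoClan = ∀ {X a b k} → IsUniform X → a ∈ X → b ∈ X → a ≢ b → k ∉ X → ⊥

  module _ {ℓ} {P R : Rel (Fin n) ℓ} (C : Colouring s P R) (noClan : NoClan) where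
    open Colouring C

    -- Induction on the size of X: it may be assumed minimal, and then it is a clan, because for
    -- R x y in X and k outside neither of xk, yk is in R, so the triangle forces s x k ≈ s y k.
    noProperClosed : ∀ {a b} → R a b → ∀ {X k} → Acc ℕ._<_ ∣ X ∣ → Separated R ⊤ X →
                     a ∈ X → k ∉ X → ⊥
    noProperClosed {a} {b} Rab {X} (acc rs) sep a∈X k∉X =
      noClan (λ i j k i∈X j∈X k∉X → trans (uniform i∈X k∉X) (sym (uniform j∈X k∉X)))
        a∈X b∈X (λ { ≡.refl → R-nz Rab (s-irrefl a) }) k∉X
      where
      open Separated sep

      s-irrefl : ∀ x → s x x ≈ 0#
      s-irrefl x = decidable-stable (s x x ≟ 0#) λ nz → x≉-x nz (s-skew x x)

      b∈X : b ∈ X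
      b∈X = decidable-stable (b ∈? X) λ b∉X → noEdge a∈X ∈⊤ b∉X Rab

      uniform : ∀ {i k} → i ∈ X → k ∉ X → s i k ≈ s a k
      uniform {i} {k} i∈X k∉X = decidable-stable (s i k ≟ s a k) λ i≉a →
        -- A failing `i` would make the level set of `s _ k` through `a` a strictly smaller
        -- separated set that still contains `a`.
        noProperClosed Rab {k = k}
          (rs (p⊂q⇒∣p∣<∣q∣ (proj₁ ∘ ∈⟪⟫⁻ G? , i , i∈X , i≉a ∘ proj₂ ∘ ∈⟪⟫⁻ G?)))
          (record { ⊆U = λ _ → ∈⊤ ; noEdge = G-noEdge })
          (∈⟪⟫⁺ G? (a∈X , refl)) (k∉X ∘ proj₁ ∘ ∈⟪⟫⁻ G?)
        where
        G? : U.Decidable (λ x → x ∈ X × s x k ≈ s a k)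
        G? x = (x ∈? X) ×-dec (s x k ≟ s a k)

        R-constant : ∀ {x y} → x ∈ X → y ∈ X → R x y → s x k ≈ s y k
        R-constant {x} {y} x∈X y∈X Rxy with colour x k | colour y k
        ... | inj₂ (inj₂ Rxk) | _               = contradiction Rxk (noEdge x∈X ∈⊤ k∉X)
        ... | _               | inj₂ (inj₂ Ryk) = contradiction Ryk (noEdge y∈X ∈⊤ k∉X)
        ... | inj₁ xk≈0       | inj₁ yk≈0       = trans xk≈0 (sym yk≈0)
        ... | inj₂ (inj₁ Pxk) | _               with mixed (P-sym Pxk) Rxy
        ...   | inj₁ (_ , e)   = flip₂ e
        ...   | inj₂ (Rky , _) = contradiction (R-sym Rky) (noEdge y∈X ∈⊤ k∉X)
        R-constant {x} {y} x∈X y∈X Rxy | inj₁ _ | inj₂ (inj₁ Pyk) with mixed (P-sym Pyk) (R-sym Rxy)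
        ...   | inj₁ (_ , e)   = sym (flip₂ e)
        ...   | inj₂ (Rkx , _) = contradiction (R-sym Rkx) (noEdge x∈X ∈⊤ k∉X)

        G-noEdge : ∀ {x y} → x ∈ ⟪ G? ⟫ → y ∈ ⊤ → y ∉ ⟪ G? ⟫ → ¬ R x y
        G-noEdge {x} {y} x∈G _ y∉G Rxy with ∈⟪⟫⁻ G? x∈G | y ∈? X
        ... | x∈X , _ | no y∉X  = noEdge x∈X ∈⊤ y∉X Rxy
        ... | x∈X , e | yes y∈X =
          y∉G (∈⟪⟫⁺ G? (y∈X , trans (sym (R-constant x∈X y∈X Rxy)) e))

    ⊤-connected : ∀ {a b} → R a b → ¬ Disconnected R ⊤
    ⊤-connected {a} Rab record { part = X ; separated = sep ; x₀∈part = x₀∈X ; y₀∉part = y₀∉X }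
      with a ∈? X
    ... | yes a∈X = noProperClosed Rab (<-wellFounded _) sep a∈X y₀∉X
    ... | no a∉X  =
      noProperClosed Rab (<-wellFounded _) (∖-separated R-sym sep) (∈∖⁺ ∈⊤ a∉X) (∉∖ x₀∈X)

    module _ {U : Subset n}
      (connectedᴾ : ∀ {v} → v ∉ U → ¬ Disconnected P (U ∪ ⁅ v ⁆))
      (connectedᴿ : ∀ {v} → v ∉ U → ¬ Disconnected R (U ∪ ⁅ v ⁆))
      (noCut : ∀ {X p q u} → p ∈ X → q ∉ X → ¬ (∀ {x y} → x ∈ X → y ∉ X → s x y ≈ u))
      where

      private
        ∈∪⁅⁆⁻ : ∀ {v x} → x ∈ U ∪ ⁅ v ⁆ → x ∈ U ⊎ x ≡ v
        ∈∪⁅⁆⁻ {v} = Sum.map₂ (x∈⁅y⁆⇒x≡y v) ∘ x∈p∪q⁻ U ⁅ v ⁆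

      -- Without such an edge, `X` would remain separated after adding `v` to `U`, contradicting
      -- connectedness there.
      meetsᴿ : ∀ {v X x y} → v ∉ U → Separated R U X → x ∈ X → y ∈ U → y ∉ X →
               ∃[ r ] r ∈ X × R v r
      meetsᴿ {v} {X} v∉U sep x∈X y∈U y∉X = decidable-stable
        (any? λ r → (r ∈? X) ×-dec R? v r) λ none → connectedᴿ v∉U (record
          { part = X
          ; separated = record
            { ⊆U = p⊆p∪q ⁅ v ⁆ ∘ Separated.⊆U sep
            ; noEdge = λ x∈X y∈U+v y∉X Rxy →
                [ (λ y∈U → Separated.noEdge sep x∈X y∈U y∉X Rxy)
                , (λ { ≡.refl → none (_ , x∈X , R-sym Rxy) }) ]′ (∈∪⁅⁆⁻ y∈U+v)
            }
          ; x₀∈part = x∈X ; y₀∈U = p⊆p∪q ⁅ v ⁆ y∈U ; y₀∉part = y∉X })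

      -- Otherwise `U` itself would be separated from `v` in the P-graph on the enlarged set.
      meetsᴾ : ∀ {x} → x ∈ U → ∀ {v} → v ∉ U → ∃[ p ] p ∈ U × P v p
      meetsᴾ x∈U {v} v∉U = decidable-stable
        (any? λ p → (p ∈? U) ×-dec P? v p) λ none → connectedᴾ v∉U (record
          { part = U
          ; separated = record
            { ⊆U = p⊆p∪q ⁅ v ⁆
            ; noEdge = λ x∈U y∈U+v y∉U Pxy →
                [ y∉U , (λ { ≡.refl → none (_ , x∈U , P-sym Pxy) }) ]′ (∈∪⁅⁆⁻ y∈U+v)
            }
          ; x₀∈part = x∈U ; y₀∈U = q⊆p∪q U ⁅ v ⁆ (x∈⁅x⁆ v) ; y₀∉part = v∉U })

      -- The recursive call supplies the minimality of F, so F need not be taken as a component.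
      noSeparation : ∀ {v p q F} → v ∉ U → P p v → Acc ℕ._<_ ∣ F ∣ → Separated R U F →
                     p ∈ F → q ∈ U → q ∉ F → ⊥
      noSeparation v∉U Ppv (acc rs) sep p∈F q∈U q∉F = noCut p₀∈upper q₀∉upper upper-cut
        where
        open Cut C sep p∈F q∈U q∉F v∉U Ppv (meetsᴾ q∈U) meetsᴿ
          (λ G-sep G⊆F p∈G f∈F f∉G →
            noSeparation v∉U Ppv (rs (p⊂q⇒∣p∣<∣q∣ (G⊆F , _ , f∈F , f∉G)))
              G-sep p∈G q∈U (q∉F ∘ G⊆F))

      noDisconnection : ∀ {v} → v ∉ U → ¬ Disconnected R U
      noDisconnection v∉U
        record { part = X ; separated = sep ; x₀∈part = x∈X ; y₀∈U = y∈U ; y₀∉part = y∉X }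
        with meetsᴾ y∈U v∉U
      -- The P-neighbour `p` of `v` serves as `p₀`; `F` is started as the side of the separation
      -- that contains it.
      ... | p , p∈U , Pvp with p ∈? X
      ...   | yes p∈X = noSeparation v∉U (P-sym Pvp) (<-wellFounded _) sep p∈X y∈U y∉X
      ...   | no p∉X  = noSeparation v∉U (P-sym Pvp) (<-wellFounded _) (∖-separated R-sym sep)
                          (∈∖⁺ p∈U p∉X) (Separated.⊆U sep x∈X) (∉∖ x∈X)

  module _ {ℓ} {P R : Rel (Fin n) ℓ} (C : Colouring s P R) (noClan : NoClan)
    (noCut : ∀ {X p q u} → p ∈ X → q ∉ X → ¬ (∀ {x y} → x ∈ X → y ∉ X → s x y ≈ u))
    where

    -- Going down from ⊤, the recursive call supplies the maximality of U.
    allConnected : ∀ {a b c d} → P a b → R c d → ∀ U → Acc ℕ._<_ ∣ ∁ U ∣ →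
                   ¬ Disconnected P U × ¬ Disconnected R U
    allConnected Pab Rcd U (acc rs) with any? (λ v → ¬? (v ∈? U))
    ... | yes (v , v∉U) =
      noDisconnection (swap C) noClan (λ v∉U → proj₂ (next v∉U)) (λ v∉U → proj₁ (next v∉U)) noCut v∉U ,
      noDisconnection C noClan (λ v∉U → proj₁ (next v∉U)) (λ v∉U → proj₂ (next v∉U)) noCut v∉U
      where
      next : ∀ {v} → v ∉ U → ¬ Disconnected P (U ∪ ⁅ v ⁆) × ¬ Disconnected R (U ∪ ⁅ v ⁆)
      next {v} v∉U = allConnected Pab Rcd (U ∪ ⁅ v ⁆) (rs (p⊂q⇒∣p∣<∣q∣ (p⊂q⇒∁p⊃∁q
        (p⊆p∪q ⁅ v ⁆ , v , q⊆p∪q U ⁅ v ⁆ (x∈⁅x⁆ v) , v∉U))))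
    ... | no all∈U with ⊆-antisym (⊆⊤ {p = U}) (λ {x} _ → decidable-stable (x ∈? U) λ x∉U → all∈U (x , x∉U))
    ...   | ≡.refl = ⊤-connected (swap C) noClan Pab , ⊤-connected C noClan Rcd

    -- If both colours occurred, every vertex set would be R-connected; but the two ends of a P-edge
    -- form an R-disconnected set.
    monochromatic : ∀ {a b c d} → P a b → ¬ R c d
    monochromatic {a} {b} Pab Rcd =
      proj₂ (allConnected Pab Rcd (⁅ a ⁆ ∪ ⁅ b ⁆) (<-wellFounded _)) (record
        { part      = ⁅ a ⁆
        ; separated = record { ⊆U = p⊆p∪q ⁅ b ⁆ ; noEdge = noEdge }
        ; x₀∈part   = x∈⁅x⁆ a
        ; y₀∈U      = q⊆p∪q ⁅ a ⁆ ⁅ b ⁆ (x∈⁅x⁆ b)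
        ; y₀∉part   = λ b∈ → b≢a (x∈⁅y⁆⇒x≡y a b∈)
        })
      where
      open Colouring C

      b≢a : b ≢ a
      b≢a ≡.refl = x≉-x (P-nz Pab) (s-skew a a)

      noEdge : ∀ {x y} → x ∈ ⁅ a ⁆ → y ∈ ⁅ a ⁆ ∪ ⁅ b ⁆ → y ∉ ⁅ a ⁆ → ¬ R x y
      noEdge x∈ y∈ y∉ Rxy with x∈⁅y⁆⇒x≡y a x∈ | x∈p∪q⁻ ⁅ a ⁆ ⁅ b ⁆ y∈
      ... | _      | inj₁ y∈a = y∉ y∈a
      ... | ≡.refl | inj₂ y∈b with x∈⁅y⁆⇒x≡y b y∈b
      ...   | ≡.refl = disjoint Pab Rxy

-- Increasing tuples, and reduction of symmetric statements to them.

Increasing : ∀ {k n} → (Fin k → Fin n) → Set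
Increasing f = ∀ {i j} → i Fin.< j → f i Fin.< f j

[]-increasing : ∀ {n} → Increasing {n = n} F.[]
[]-increasing {i = ()}

∷-increasing : ∀ {k n} {x : Fin n} {f : Fin k → Fin n} →
               (∀ i → x Fin.< f i) → Increasing f → Increasing (x F.∷ f)
∷-increasing x<f inc {zero}  {suc j} _   = x<f j
∷-increasing x<f inc {suc i} {suc j} i<j = inc (s<s⁻¹ i<j)

module _ {n p} (Q : Fin n → Fin n → Fin n → Set p)
  (swap₁₂ : ∀ {i j k} → Q i j k → Q j i k) (swap₂₃ : ∀ {i j k} → Q i j k → Q i k j)
  (diag : ∀ {i k} → Q i i k)
  (increasing : ∀ {i j k} → i Fin.< j → j Fin.< k → Q i j k)
  where

  private
    ordered : ∀ {i j} → i Fin.< j → ∀ k → Q i j k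
    ordered {i} {j} i<j k with Fin.<-cmp j k
    ... | tri< j<k _ _    = increasing i<j j<k
    ... | tri≈ _ ≡.refl _ = swap₁₂ (swap₂₃ diag)
    ... | tri> _ _ k<j with Fin.<-cmp i k
    ...   | tri< i<k _ _    = swap₂₃ (increasing i<k k<j)
    ...   | tri≈ _ ≡.refl _ = swap₂₃ diag
    ...   | tri> _ _ k<i    = swap₂₃ (swap₁₂ (increasing k<i i<j))

  -- Adjacent transpositions either sort the triple or bring a repeated index to the first two
  -- places. The first two indices are sorted here, and `ordered` inserts the third.
  symmetric₃ : ∀ i j k → Q i j k
  symmetric₃ i j k with Fin.<-cmp i j
  ... | tri< i<j _ _    = ordered i<j k
  ... | tri≈ _ ≡.refl _ = diag
  ... | tri> _ _ j<i    = swap₁₂ (ordered j<i k)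

module _ {n p} (Q : Fin n → Fin n → Fin n → Fin n → Set p)
  (swap₁₂ : ∀ {i j k l} → Q i j k l → Q j i k l)
  (swap₂₃ : ∀ {i j k l} → Q i j k l → Q i k j l)
  (swap₃₄ : ∀ {i j k l} → Q i j k l → Q i j l k)
  (diag : ∀ {i k l} → Q i i k l)
  (increasing : ∀ {i j k l} → i Fin.< j → j Fin.< k → k Fin.< l → Q i j k l)
  where

  private
    ordered : ∀ {i j k} → i Fin.< j → j Fin.< k → ∀ l → Q i j k l
    ordered {i} {j} {k} i<j j<k l with Fin.<-cmp k l
    ... | tri< k<l _ _    = increasing i<j j<k k<l
    ... | tri≈ _ ≡.refl _ = swap₂₃ (swap₃₄ (swap₁₂ (swap₂₃ diag)))
    ... | tri> _ _ l<k with Fin.<-cmp j l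
    ...   | tri< j<l _ _    = swap₃₄ (increasing i<j j<l l<k)
    ...   | tri≈ _ ≡.refl _ = swap₃₄ (swap₁₂ (swap₂₃ diag))
    ...   | tri> _ _ l<j with Fin.<-cmp i l
    ...     | tri< i<l _ _    = swap₃₄ (swap₂₃ (increasing i<l l<j j<k))
    ...     | tri≈ _ ≡.refl _ = swap₃₄ (swap₂₃ diag)
    ...     | tri> _ _ l<i    = swap₃₄ (swap₂₃ (swap₁₂ (increasing l<i i<j j<k)))

  -- The first three indices are sorted by `symmetric₃`, applied to the statement quantified over
  -- the last index; `ordered` then inserts that index.
  symmetric₄ : ∀ i j k l → Q i j k l
  symmetric₄ = symmetric₃ (λ i j k → ∀ l → Q i j k l)
    (λ q l → swap₁₂ (q l)) (λ q l → swap₂₃ (q l)) (λ l → diag) ordered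

-- From equal principal minors to equal invariants of `s`.

module PrincipalMinors {c ℓ₁ ℓ₂} (ℝ : CompleteOrderedField c ℓ₁ ℓ₂) where
  open CompleteOrderedField ℝ hiding (zero; _≤_)
  open Matrices ℝ
  open Minors ℝ
  open Field ℝ
  open RingProperties ring

  -- The size is an index of the family, so matching on `enumerates` identifies `k` with the
  -- cardinality of `X` and no casts between `Fin` types arise.
  data Enumerates {n} (X : Subset n) : ∀ {k} → (Fin k → Fin n) → Set where
    enumerates : ∀ {f : Fin ∣ X ∣ → Fin n} → (∀ i → enumerate X i ≡ f i) → Enumerates X f

  private
    lowered : ∀ {k n} {f : Fin k → Fin (suc n)} → Increasing f → (∀ i → zero {n} Fin.< f i) →
              ∃[ g ] Increasing g × (∀ i → f i ≡ suc (g i))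
    lowered {f = f} inc 0<f = proj₁ ∘ pred , inc′ , proj₂ ∘ pred
      where
      pred : ∀ i → ∃[ y ] f i ≡ suc y
      pred i with f i | 0<f i
      ... | suc y | _ = y , ≡.refl

      inc′ : Increasing (proj₁ ∘ pred)
      inc′ {i} {j} i<j = s<s⁻¹ (≡.subst₂ Fin._<_ (proj₂ (pred i)) (proj₂ (pred j)) (inc i<j))

  -- Induction on `n`: if the first value of `f` is `zero`, then `zero` is put into `X`; otherwise
  -- all values are positive and can be lowered by one.
  increasing⇒enumerates : ∀ {n k} (f : Fin k → Fin n) → Increasing f → ∃[ X ] Enumerates X f
  increasing⇒enumerates {zero}  {zero}  f inc = [] , enumerates λ ()
  increasing⇒enumerates {zero}  {suc k} f inc with () ← f zero
  increasing⇒enumerates {suc n} {k} f inc = split k f inc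
    where
    skip : ∀ {k} (f : Fin k → Fin (suc n)) → Increasing f → (∀ i → zero {n} Fin.< f i) →
           ∃[ X ] Enumerates X f
    skip f inc 0<f with lowered inc 0<f
    ... | g , g-inc , f≡ with increasing⇒enumerates g g-inc
    ...   | X , enumerates eq =
      outside ∷ X , enumerates λ i → ≡.trans (≡.cong suc (eq i)) (≡.sym (f≡ i))

    split : ∀ k (f : Fin k → Fin (suc n)) → Increasing f → ∃[ X ] Enumerates X f
    split zero    f inc = skip f inc λ ()
    split (suc k) f inc with f zero in f0≡
    ... | suc y = skip f inc λ
      { zero    → ≡.subst (zero {n} Fin.<_) (≡.sym f0≡) z<s
      ; (suc i) → ℕ.<-trans (≡.subst (zero {n} Fin.<_) (≡.sym f0≡) z<s) (inc {zero} {suc i} z<s) }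
    ... | zero with lowered {f = f ∘ suc} (inc ∘ s<s)
                      (λ i → ≡.subst (Fin._< f (suc i)) f0≡ (inc {zero} {suc i} z<s))
    ...   | g , g-inc , f≡ with increasing⇒enumerates g g-inc
    ...     | X , enumerates eq = inside ∷ X , enumerates λ
      { zero → ≡.sym f0≡ ; (suc i) → ≡.trans (≡.cong suc (eq i)) (≡.sym (f≡ i)) }

  EqualMinors : ∀ {n} → ℕ → Matrix n → Matrix n → Set ℓ₁
  EqualMinors m A B = ∀ X → ∣ X ∣ ℕ.≤ m → principalMinor A X ≈ principalMinor B X

  det-submatrix : ∀ {n m k} {A B : Matrix n} → EqualMinors m A B → k ℕ.≤ m →
                  (f : Fin k → Fin n) → Increasing f →
                  det (λ i j → A (f i) (f j)) ≈ det (λ i j → B (f i) (f j))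
  det-submatrix {A = A} {B} minors k≤m f inc with increasing⇒enumerates f inc
  ... | X , enumerates eq = trans (sym (rewriteX A)) (trans (minors X k≤m) (rewriteX B))
    where
    rewriteX : ∀ M → principalMinor M X ≈ det (λ i j → M (f i) (f j))
    rewriteX M = det-cong λ i j → reflexive (≡.cong₂ M (eq i) (eq j))

  fill-unique : ∀ {n o f g} {u : Matrix n} {N : Matrix n} → (∀ i → N i i ≈ o) →
                (∀ {i j} → i Fin.< j → N i j ≈ f (u i j)) →
                (∀ {i j} → i Fin.< j → N j i ≈ g (u i j)) →
                N ≋ fill o f g u
  fill-unique diag up low zero    zero    = diag zero
  fill-unique diag up low zero    (suc j) = up z<s
  fill-unique diag up low (suc i) zero    = low z<s
  fill-unique diag up low (suc i) (suc j) =
    fill-unique (diag ∘ suc) (up ∘ s<s) (low ∘ s<s) i j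

  ½-inverse : ∃[ h ] (1# + 1#) * h ≈ 1#
  ½-inverse = inverse (1# + 1#) 2≉0

  ½ : Carrier
  ½ = proj₁ ½-inverse

  2*½≈1 : (1# + 1#) * ½ ≈ 1#
  2*½≈1 = proj₂ ½-inverse

  ½≉0 : ¬ (½ ≈ 0#)
  ½≉0 ½≈0 = 0≉1 (trans (sym (zeroʳ _)) (trans (*-congˡ (sym ½≈0)) 2*½≈1))

  *-≉0 : ∀ {x y} → ¬ (x ≈ 0#) → ¬ (y ≈ 0#) → ¬ (x * y ≈ 0#)
  *-≉0 x≉0 y≉0 xy≈0 = y≉0 (zero-product xy≈0 x≉0)

  *-cancel : ∀ {k x y} → ¬ (k ≈ 0#) → k * x ≈ k * y → x ≈ y
  *-cancel {k} {x} {y} k≉0 kx≈ky = x∙y⁻¹≈ε⇒x≈y x y (zero-product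
    (trans (x[y-z]≈xy-xz k x y) (x≈y⇒x∙y⁻¹≈ε kx≈ky)) k≉0)

  tri-cong : ∀ {x x′ y y′ z z′} → x ≈ x′ → y ≈ y′ → z ≈ z′ → tri x y z ≈ tri x′ y′ z′
  tri-cong x≈ y≈ z≈ = +-cong (+-cong (*-cong x≈ y≈) (-‿cong (*-cong y≈ z≈))) (-‿cong (*-cong z≈ x≈))

  -- The Pfaffian of the skew-symmetric matrix with rows a b c, d e, f above the diagonal.
  pf : Carrier → Carrier → Carrier → Carrier → Carrier → Carrier → Carrier
  pf a b c d e f = a * f - b * e + c * d

  pf-cong : ∀ {a a′ b b′ c c′ d d′ e e′ f f′} → a ≈ a′ → b ≈ b′ → c ≈ c′ → d ≈ d′ → e ≈ e′ →
            f ≈ f′ → pf a b c d e f ≈ pf a′ b′ c′ d′ e′ f′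
  pf-cong a≈ b≈ c≈ d≈ e≈ f≈ =
    +-cong (+-cong (*-cong a≈ f≈) (-‿cong (*-cong b≈ e≈))) (*-cong c≈ d≈)

  module _ where
    open IntegerSolver commutativeRing

    -- Exchanging two vertices reverses the 3-cycle and negates all three of its values, which
    -- leaves their pairwise products unchanged.
    tri-swap₁₂ : ∀ x y z → tri (- x) z y ≈ tri x y z
    tri-swap₁₂ = solve 3 (λ x y z → (:- x) :* z :- z :* y :- y :* (:- x) :=
                                    x :* y :- y :* z :- z :* x) refl

    tri-swap₂₃ : ∀ x y z → tri z (- y) x ≈ tri x y z
    tri-swap₂₃ = solve 3 (λ x y z → z :* (:- y) :- (:- y) :* x :- x :* z :=
                                    x :* y :- y :* z :- z :* x) refl

    tri-diag : ∀ y → tri 0# y y ≈ - (y * y)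
    tri-diag = solve 1 (λ y → con (+ 0) :* y :- y :* y :- y :* con (+ 0) := :- (y :* y)) refl

    private
      pfᴾ : ∀ {m} → Polynomial m → Polynomial m → Polynomial m → Polynomial m → Polynomial m →
            Polynomial m → Polynomial m
      pfᴾ a b c d e f = a :* f :- b :* e :+ c :* d

    -- A transposition of the indices negates the Pfaffian, so it is the square that is symmetric.
    pf²-swap₁₂ : ∀ a b c d e f → let p = pf a b c d e f; q = pf (- a) d e b c f in q * q ≈ p * p
    pf²-swap₁₂ = solve 6 (λ a b c d e f → let p = pfᴾ a b c d e f; q = pfᴾ (:- a) d e b c f in
                            q :* q := p :* p) refl

    pf²-swap₂₃ : ∀ a b c d e f → let p = pf a b c d e f; q = pf b a c (- d) f e in q * q ≈ p * p
    pf²-swap₂₃ = solve 6 (λ a b c d e f → let p = pfᴾ a b c d e f; q = pfᴾ b a c (:- d) f e in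
                            q :* q := p :* p) refl

    pf²-swap₃₄ : ∀ a b c d e f → let p = pf a b c d e f; q = pf a c b e d (- f) in q * q ≈ p * p
    pf²-swap₃₄ = solve 6 (λ a b c d e f → let p = pfᴾ a b c d e f; q = pfᴾ a c b e d (:- f) in
                            q :* q := p :* p) refl

    pf-diag : ∀ b c f → pf 0# b c b c f ≈ 0#
    pf-diag = solve 3 (λ b c f → pfᴾ (con (+ 0)) b c b c f := con (+ 0)) refl

  module _ {n} (s : Matrix n) where

    triAt : Fin n → Fin n → Fin n → Carrier
    triAt i j k = tri (s i j) (s j k) (s i k)

    pfAt : Fin n → Fin n → Fin n → Fin n → Carrier
    pfAt i j k l = pf (s i j) (s i k) (s i l) (s j k) (s j l) (s k l)

    pf²At : Fin n → Fin n → Fin n → Fin n → Carrier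
    pf²At i j k l = pfAt i j k l * pfAt i j k l

    Skew : Set ℓ₁
    Skew = ∀ i j → s j i ≈ - s i j

    module _ (sk : Skew) where
      skew-diag : ∀ i → s i i ≈ 0#
      skew-diag i = decidable-stable (s i i ≟ 0#) λ nz → x≉-x nz (sk i i)

      triAt-swap₁₂ : ∀ {i j k} → triAt j i k ≈ triAt i j k
      triAt-swap₁₂ = trans (tri-cong (sk _ _) refl refl) (tri-swap₁₂ _ _ _)

      triAt-swap₂₃ : ∀ {i j k} → triAt i k j ≈ triAt i j k
      triAt-swap₂₃ = trans (tri-cong refl (sk _ _) refl) (tri-swap₂₃ _ _ _)

      triAt-diag : ∀ {i k} → triAt i i k ≈ - (s i k * s i k)
      triAt-diag = trans (tri-cong (skew-diag _) refl refl) (tri-diag _)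

      pf²At-swap₁₂ : ∀ {i j k l} → pf²At j i k l ≈ pf²At i j k l
      pf²At-swap₁₂ = trans (*-cong e e) (pf²-swap₁₂ _ _ _ _ _ _)
        where e = pf-cong (sk _ _) refl refl refl refl refl

      pf²At-swap₂₃ : ∀ {i j k l} → pf²At i k j l ≈ pf²At i j k l
      pf²At-swap₂₃ = trans (*-cong e e) (pf²-swap₂₃ _ _ _ _ _ _)
        where e = pf-cong refl refl refl (sk _ _) refl refl

      pf²At-swap₃₄ : ∀ {i j k l} → pf²At i j l k ≈ pf²At i j k l
      pf²At-swap₃₄ = trans (*-cong e e) (pf²-swap₃₄ _ _ _ _ _ _)
        where e = pf-cong refl refl refl refl refl (sk _ _)

      pf²At-diag : ∀ {i k l} → pf²At i i k l ≈ 0#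
      pf²At-diag = trans (*-congʳ (trans (pf-cong (skew-diag _) refl refl refl refl refl)
                                         (pf-diag _ _ _))) (zeroˡ _)

  Skewed : ∀ {n} → Matrix n → Matrix n
  Skewed M i j = M i j - M j i

  Skewed-skew : ∀ {n} (M : Matrix n) → Skew (Skewed M)
  Skewed-skew M i j = sym (⁻¹-anti-homo-// (M i j) (M j i))

  module _ {n} {M : Matrix n} (T : IsGeneralizedTournament M) where
    open IsGeneralizedTournament T
    open IntegerSolver commutativeRing

    private
      s = Skewed M

      I-diag : ∀ i → I n i i ≡ 1#
      I-diag i = ≡.cong (λ b → if b then 1# else 0#) (dec-true (i Fin.≟ i) ≡.refl)

      I-off : ∀ {i j} → i ≢ j → I n i j ≡ 0#
      I-off i≢j = ≡.cong (λ b → if b then 1# else 0#) (dec-false (_ Fin.≟ _) i≢j)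

    diagonal : ∀ i → M i i ≈ 0#
    diagonal i = x+x≈0⇒x≈0 (trans (M+Mᵗ≋J-I i i)
      (trans (+-congˡ (-‿cong (reflexive (I-diag i)))) (-‿inverseʳ 1#)))

    sum≈1 : ∀ {i j} → i ≢ j → M i j + M j i ≈ 1#
    sum≈1 i≢j = trans (M+Mᵗ≋J-I _ _)
      (trans (+-congˡ (trans (-‿cong (reflexive (I-off i≢j))) -0#≈0#)) (+-identityʳ 1#))

    entry : ∀ {i j} → i ≢ j → M i j ≈ ½ * (1# + s i j)
    entry {i} {j} i≢j = sym (trans (*-congˡ (+-congʳ (sym (sum≈1 i≢j))))
      (trans (lemma ½ (M i j) (M j i)) (trans (*-congʳ 2*½≈1) (*-identityˡ _))))
      where
      lemma : ∀ h x y → h * ((x + y) + (x - y)) ≈ ((1# + 1#) * h) * x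
      lemma = solve 3 (λ h x y → h :* ((x :+ y) :+ (x :- y)) :=
                                 ((con (+ 1) :+ con (+ 1)) :* h) :* x) refl

    entryᵗ : ∀ {i j} → i ≢ j → M j i ≈ ½ * (1# - s i j)
    entryᵗ i≢j = trans (entry (i≢j ∘ ≡.sym)) (*-congˡ (+-congˡ (Skewed-skew M _ _)))

    submatrix : ∀ {k} (f : Fin k → Fin n) → Increasing f →
                (λ i j → M (f i) (f j)) ≋ skew ½ (λ i j → s (f i) (f j))
    submatrix f inc = fill-unique (λ i → diagonal (f i))
      (λ i<j → entry (Fin.<⇒≢ (inc i<j))) (λ i<j → entryᵗ (Fin.<⇒≢ (inc i<j)))

  record Equivalent {n} (s s′ : Matrix n) : Set ℓ₁ where
    field
      s-skew  : Skew s
      s′-skew : Skew s′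
      squares : ∀ i j → s i j * s i j ≈ s′ i j * s′ i j
      tris    : ∀ i j k → triAt s i j k ≈ triAt s′ i j k
      pf²s    : ∀ i j k l → pf²At s i j k l ≈ pf²At s′ i j k l

  -- Equality of squares, triangle sums and squared Pfaffians.

  module _ {n} {A B : Matrix n} (TA : IsGeneralizedTournament A) (TB : IsGeneralizedTournament B)
    (minors : EqualMinors 4 A B) where

    private
      s = Skewed A
      s′ = Skewed B
      skewA = Skewed-skew A
      skewB = Skewed-skew B

      minors≈ : ∀ {k} {Φ : Matrix k → Carrier} → (∀ t → det (skew ½ t) ≈ Φ t) →
                k ℕ.≤ 4 → (f : Fin k → Fin n) → Increasing f →
                Φ (λ i j → s (f i) (f j)) ≈ Φ (λ i j → s′ (f i) (f j))
      minors≈ det≈Φ k≤4 f inc =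
        trans (sym (trans (det-cong (submatrix TA f inc)) (det≈Φ _)))
          (trans (det-submatrix {A = A} {B} minors k≤4 f inc)
            (trans (det-cong (submatrix TB f inc)) (det≈Φ _)))

      pair-increasing : ∀ {i j : Fin n} → i Fin.< j → Increasing (i F.∷ j F.∷ F.[])
      pair-increasing i<j = ∷-increasing (λ { zero → i<j }) (∷-increasing (λ ()) []-increasing)

      triple-increasing : ∀ {i j k : Fin n} → i Fin.< j → j Fin.< k →
                          Increasing (i F.∷ j F.∷ k F.∷ F.[])
      triple-increasing i<j j<k = ∷-increasing
        (λ { zero → i<j ; (suc zero) → Fin.<-trans i<j j<k }) (pair-increasing j<k)

      quadruple-increasing : ∀ {i j k l : Fin n} → i Fin.< j → j Fin.< k → k Fin.< l →
                             Increasing (i F.∷ j F.∷ k F.∷ l F.∷ F.[])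
      quadruple-increasing i<j j<k k<l = ∷-increasing
        (λ { zero → i<j ; (suc zero) → Fin.<-trans i<j j<k
           ; (suc (suc zero)) → Fin.<-trans i<j (Fin.<-trans j<k k<l) })
        (triple-increasing j<k k<l)

      squares-increasing : ∀ {i j} → i Fin.< j → s i j * s i j ≈ s′ i j * s′ i j
      squares-increasing {i} {j} i<j = +-cancelʳ (- 1#) _ _ (*-cancel (*-≉0 ½≉0 ½≉0)
        (minors≈ (det₂-skew ½) (s≤s (s≤s z≤n)) (i F.∷ j F.∷ F.[]) (pair-increasing i<j)))

      square-sym : ∀ (M : Matrix n) → Skew M → ∀ i j → M j i * M j i ≈ M i j * M i j
      square-sym M sk i j = trans (*-cong (sk i j) (sk i j))
        (trans (sym (-‿distribˡ-* _ _)) (trans (-‿cong (sym (-‿distribʳ-* _ _))) (-‿involutive _)))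

    squares≈ : ∀ i j → s i j * s i j ≈ s′ i j * s′ i j
    squares≈ i j with Fin.<-cmp i j
    ... | tri< i<j _ _    = squares-increasing i<j
    ... | tri≈ _ ≡.refl _ = trans (*-cong z z) (sym (*-cong z′ z′))
      where
      z = skew-diag s skewA i
      z′ = skew-diag s′ skewB i
    ... | tri> _ _ j<i    = trans (square-sym s skewA j i)
      (trans (squares-increasing j<i) (sym (square-sym s′ skewB j i)))

    tris≈ : ∀ i j k → triAt s i j k ≈ triAt s′ i j k
    tris≈ = symmetric₃ (λ i j k → triAt s i j k ≈ triAt s′ i j k)
      (λ e → trans (triAt-swap₁₂ s skewA) (trans e (sym (triAt-swap₁₂ s′ skewB))))
      (λ e → trans (triAt-swap₂₃ s skewA) (trans e (sym (triAt-swap₂₃ s′ skewB))))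
      -- With a repeated index the triangle sum degenerates to minus a square, which order 2
      -- controls.
      (trans (triAt-diag s skewA) (trans (-‿cong (squares≈ _ _)) (sym (triAt-diag s′ skewB))))
      (λ {i} {j} {k} i<j j<k → +-cancelˡ 1# _ _ (*-cancel 2≉0
        (*-cancel (*-≉0 (*-≉0 ½≉0 ½≉0) ½≉0)
          (minors≈ (det₃-skew ½) (s≤s (s≤s (s≤s z≤n))) (i F.∷ j F.∷ k F.∷ F.[])
            (triple-increasing i<j j<k)))))

    pf²s≈ : ∀ i j k l → pf²At s i j k l ≈ pf²At s′ i j k l
    pf²s≈ = symmetric₄ (λ i j k l → pf²At s i j k l ≈ pf²At s′ i j k l)
      (λ e → trans (pf²At-swap₁₂ s skewA) (trans e (sym (pf²At-swap₁₂ s′ skewB))))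
      (λ e → trans (pf²At-swap₂₃ s skewA) (trans e (sym (pf²At-swap₂₃ s′ skewB))))
      (λ e → trans (pf²At-swap₃₄ s skewA) (trans e (sym (pf²At-swap₃₄ s′ skewB))))
      (trans (pf²At-diag s skewA) (sym (pf²At-diag s′ skewB)))
      (λ {i} {j} {k} {l} i<j j<k k<l →
        -- Everything in the order 4 formula apart from the squared Pfaffian agrees by orders 2 and
        -- 3, and is cancelled.
        +-cancelʳ _ _ _ (trans (*-cancel (*-≉0 (*-≉0 (*-≉0 ½≉0 ½≉0) ½≉0) ½≉0)
          (minors≈ (det₄-skew ½) ℕ.≤-refl (i F.∷ j F.∷ k F.∷ l F.∷ F.[])
            (quadruple-increasing i<j j<k k<l)))
          (+-congˡ (-‿cong (sym (+-cong
            (+-congˡ (+-cong (+-cong (+-cong (+-cong (+-cong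
              (squares≈ i j) (squares≈ i k)) (squares≈ i l)) (squares≈ j k)) (squares≈ j l))
              (squares≈ k l)))
            (*-congˡ (+-cong (+-cong (+-cong
              (tris≈ i j k) (tris≈ i j l)) (tris≈ i k l)) (tris≈ j k l)))))))))

    equivalent : Equivalent s s′
    equivalent = record
      { s-skew = skewA ; s′-skew = skewB ; squares = squares≈ ; tris = tris≈ ; pf²s = pf²s≈ }

-- The colouring defined by two matrices, and the recovery of `A`.

module Reconstruction {c ℓ₁ ℓ₂} (ℝ : CompleteOrderedField c ℓ₁ ℓ₂) where
  open CompleteOrderedField ℝ hiding (zero; _≤_)
  open Matrices ℝ
  open Minors ℝ
  open Field ℝ
  open Core ℝ
  open PrincipalMinors ℝ
  open RingProperties ring
  open IntegerSolver commutativeRing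

  square≈⇒± : ∀ {x y} → x * x ≈ y * y → y ≈ x ⊎ y ≈ - x
  square≈⇒± {x} {y} x²≈y² with y ≟ x
  ... | yes y≈x = inj₁ y≈x
  ... | no y≉x  = inj₂ (+-inverseˡ-unique y x (zero-product
    (trans (factor x y) (x≈y⇒x∙y⁻¹≈ε (sym x²≈y²))) (y≉x ∘ x∙y⁻¹≈ε⇒x≈y y x)))
    where
    factor : ∀ x y → (y - x) * (y + x) ≈ y * y - x * x
    factor = solve 2 (λ x y → (y :- x) :* (y :+ x) := y :* y :- x :* x) refl

  -- The order 3 condition for a triangle with exactly one reversed edge, the one of value `y`.
  tri-lone₂ : ∀ {x y z} → ¬ (y ≈ 0#) → tri x y z ≈ tri x (- y) z → x ≈ z
  tri-lone₂ {x} {y} {z} y≉0 e = x∙y⁻¹≈ε⇒x≈y x z (zero-product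
    (x+x≈0⇒x≈0 (trans (identity x y z) (x≈y⇒x∙y⁻¹≈ε e))) y≉0)
    where
    identity : ∀ x y z → y * (x - z) + y * (x - z) ≈ tri x y z - tri x (- y) z
    identity = solve 3 (λ x y z → y :* (x :- z) :+ y :* (x :- z) :=
                          triᴾ x y z :- triᴾ x (:- y) z) refl

  -- The order 3 condition for a triangle with exactly one preserved edge, the one of value `x`.
  tri-lone₁ : ∀ {x y z} → ¬ (x ≈ 0#) → tri x y z ≈ tri x (- y) (- z) → z ≈ y
  tri-lone₁ {x} {y} {z} x≉0 e = sym (x∙y⁻¹≈ε⇒x≈y y z (zero-product
    (x+x≈0⇒x≈0 (trans (identity x y z) (x≈y⇒x∙y⁻¹≈ε e))) x≉0))
    where
    identity : ∀ x y z → x * (y - z) + x * (y - z) ≈ tri x y z - tri x (- y) (- z)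
    identity = solve 3 (λ x y z → x :* (y :- z) :+ x :* (y :- z) :=
                          triᴾ x y z :- triᴾ x (:- y) (:- z)) refl

  -- The difference of the two squares is `4tw(t² - w²)`.
  quad-values : ∀ {t w} → ¬ (t ≈ 0#) → ¬ (w ≈ 0#) →
    let p = t * t - w * w + t * w; q = t * t - w * w - t * w in
    p * p ≈ q * q → w ≈ t ⊎ w ≈ - t
  quad-values {t} {w} t≉0 w≉0 e = square≈⇒± (x∙y⁻¹≈ε⇒x≈y _ _ (zero-product
    (x+x≈0⇒x≈0 (x+x≈0⇒x≈0 (trans (identity t w) (x≈y⇒x∙y⁻¹≈ε e)))) (*-≉0 t≉0 w≉0)))
    where
    identity : ∀ t w → let p = t * t - w * w + t * w; q = t * t - w * w - t * w
                           r = (t * w) * (t * t - w * w) in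
               (r + r) + (r + r) ≈ p * p - q * q
    identity = solve 2 (λ t w → let p = t :* t :- w :* w :+ t :* w
                                    q = t :* t :- w :* w :- t :* w
                                    r = (t :* w) :* (t :* t :- w :* w) in
                 (r :+ r) :+ (r :+ r) := p :* p :- q :* q) refl

  module _ {n} {s s′ : Matrix n} (eq : Equivalent s s′) where
    open Equivalent eq

    Preserved Reversed : Rel (Fin n) ℓ₁
    Preserved x y = ¬ (s x y ≈ 0#) × s′ x y ≈ s x y
    Reversed  x y = ¬ (s x y ≈ 0#) × s′ x y ≈ - s x y

    private
      nz-sym : ∀ {x y} → ¬ (s x y ≈ 0#) → ¬ (s y x ≈ 0#)
      nz-sym nz yx≈0 = nz (trans (s-skew _ _) (trans (-‿cong yx≈0) -0#≈0#))

    sign : ∀ x y → s′ x y ≈ s x y ⊎ s′ x y ≈ - s x y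
    sign x y = square≈⇒± (squares x y)

    private
      mixed : ∀ {a b c} → Preserved a b → Reversed b c →
              (Preserved a c × s a b ≈ s a c) ⊎ (Reversed a c × s a c ≈ s b c)
      mixed {a} {b} {c} (ab≉0 , ab) (bc≉0 , bc) with sign a c
      -- That `s a c` is non-zero comes out of the triangle, which equates it with the value of a
      -- coloured edge.
      ... | inj₁ ac = inj₁ (((λ ac≈0 → ab≉0 (trans ab≈ac ac≈0)) , ac) , ab≈ac)
        where
        ab≈ac : s a b ≈ s a c
        ab≈ac = tri-lone₂ bc≉0 (trans (tris a b c) (tri-cong ab bc ac))
      ... | inj₂ ac = inj₂ (((λ ac≈0 → bc≉0 (trans (sym ac≈bc) ac≈0)) , ac) , ac≈bc)
        where
        ac≈bc : s a c ≈ s b c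
        ac≈bc = tri-lone₁ ab≉0 (trans (tris a b c) (tri-cong ab bc ac))

      -- In the order `p v r q` the Pfaffian of the configuration depends only on `t` and `w`. It is
      -- used for `s`, and for `s′` with one of `t`, `w` negated; either negation flips just the
      -- sign of the term `t * w`.
      pfAt-quad : ∀ (σ : Matrix n) {v p q r t w} →
        σ p v ≈ t → σ p q ≈ t → σ r q ≈ t → σ v r ≈ w → σ v q ≈ w → σ p r ≈ w →
        pfAt σ p v r q ≈ t * t - w * w + t * w
      pfAt-quad σ pv pq rq vr vq pr = pf-cong pv pr pq vr vq rq

      quad : ∀ {v p q r t w} → ¬ (s p v ≈ 0#) → ¬ (s v r ≈ 0#) →
        s p v ≈ t → s p q ≈ t → s r q ≈ t → s v r ≈ w → s v q ≈ w → s p r ≈ w →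
        pfAt s′ p v r q ≈ t * t - w * w - t * w → w ≈ t ⊎ w ≈ - t
      quad {v} {p} {q} {r} pv≉0 vr≉0 pv pq rq vr vq pr e′ = quad-values
        (λ t≈0 → pv≉0 (trans pv t≈0)) (λ w≈0 → vr≉0 (trans vr w≈0))
        (trans (sym (*-cong e e)) (trans (pf²s p v r q) (*-cong e′ e′)))
        where e = pfAt-quad s pv pq rq vr vq pr

      keep : ∀ {x y a} → Preserved x y → s x y ≈ a → s′ x y ≈ a
      keep (_ , e) xy = trans e xy

      turn : ∀ {x y a} → Reversed x y → s x y ≈ a → s′ x y ≈ - a
      turn (_ , e) xy = trans e (-‿cong xy)

      P-sym : ∀ {x y} → Preserved x y → Preserved y x
      P-sym (nz , e) = nz-sym nz ,
        trans (s′-skew _ _) (trans (-‿cong e) (sym (s-skew _ _)))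

      R-sym : ∀ {x y} → Reversed x y → Reversed y x
      R-sym (nz , e) = nz-sym nz ,
        trans (s′-skew _ _) (-‿cong (trans e (sym (s-skew _ _))))

      P? : ∀ x y → Dec (Preserved x y)
      P? x y = ¬? (s x y ≟ 0#) ×-dec (s′ x y ≟ s x y)

      R? : ∀ x y → Dec (Reversed x y)
      R? x y = ¬? (s x y ≟ 0#) ×-dec (s′ x y ≟ - s x y)

      colour : ∀ x y → s x y ≈ 0# ⊎ (Preserved x y ⊎ Reversed x y)
      colour x y with s x y ≟ 0#
      ... | yes xy≈0 = inj₁ xy≈0
      ... | no xy≉0  = inj₂ (Sum.map (xy≉0 ,_) (xy≉0 ,_) (sign x y))

      flip-w : ∀ t w → t * t - (- w) * (- w) + t * (- w) ≈ t * t - w * w - t * w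
      flip-w = solve 2 (λ t w → t :* t :- (:- w) :* (:- w) :+ t :* (:- w) :=
                                t :* t :- w :* w :- t :* w) refl

      flip-t : ∀ t w → (- t) * (- t) - w * w + (- t) * w ≈ t * t - w * w - t * w
      flip-t = solve 2 (λ t w → (:- t) :* (:- t) :- w :* w :+ (:- t) :* w :=
                                t :* t :- w :* w :- t :* w) refl

    colouring : Colouring s Preserved Reversed
    colouring = record
      { s-skew   = s-skew
      ; P?       = P?
      ; R?       = R?
      ; P-sym    = P-sym
      ; R-sym    = R-sym
      ; P-nz     = proj₁
      ; R-nz     = proj₁
      ; disjoint = λ (nz , e) (_ , e′) → x≉-x nz (trans (sym e) e′)
      ; colour   = colour
      ; mixed    = mixed
      ; quadᴾ    = λ {v} {p} {q} {r} {t} {w} Pvp Ppq Pqr Rvq Rvr Rpr pv pq rq vr vq pr →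
          quad (nz-sym (proj₁ Pvp)) (proj₁ Rvr) pv pq rq vr vq pr (trans
            (pfAt-quad s′ (keep (P-sym Pvp) pv) (keep Ppq pq) (keep (P-sym Pqr) rq)
              (turn Rvr vr) (turn Rvq vq) (turn Rpr pr)) (flip-w t w))
      ; quadᴿ    = λ {v} {p} {q} {r} {t} {w} Rvp Rpq Rqr Pvq Pvr Ppr pv pq rq vr vq pr →
          quad (nz-sym (proj₁ Rvp)) (proj₁ Pvr) pv pq rq vr vq pr (trans
            (pfAt-quad s′ (turn (R-sym Rvp) pv) (turn Rpq pq) (turn (R-sym Rqr) rq)
              (keep Pvr vr) (keep Pvq vq) (keep Ppr pr)) (flip-t t w))
      }

  module _ {n} {A : Matrix n} (T : IsGeneralizedTournament A) (indecomposable : Indecomposable A)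
    where
    open Connectivity ℝ {s = Skewed A}

    private
      s = Skewed A

      s-skew : Skew s
      s-skew = Skewed-skew A

    noClan : NoClan
    noClan {X} uniform a∈X b∈X a≢b k∉X with indecomposable X clan
      where
      clan : IsClan A X
      clan i j k i∈X j∈X k∉X =
        trans (entry T i≢k) (trans (*-congˡ (+-congˡ ik≈jk)) (sym (entry T j≢k))) ,
        trans (entryᵗ T i≢k) (trans (*-congˡ (+-congˡ (-‿cong ik≈jk))) (sym (entryᵗ T j≢k)))
        where
        ik≈jk = uniform i j k i∈X j∈X k∉X
        i≢k : i ≢ k
        i≢k ≡.refl = k∉X i∈X
        j≢k : j ≢ k
        j≢k ≡.refl = k∉X j∈X
    ... | inj₁ ≡.refl              = ∉⊥ a∈X
    ... | inj₂ (inj₁ (i , ≡.refl)) =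
      a≢b (≡.trans (x∈⁅y⁆⇒x≡y i a∈X) (≡.sym (x∈⁅y⁆⇒x≡y i b∈X)))
    ... | inj₂ (inj₂ ≡.refl)       = k∉X ∈⊤

    -- Both sides of a constant cut are clans. By the pigeonhole principle one side has two
    -- vertices, and since the other side is inhabited it is a non-trivial clan.
    noCut : 2 ℕ.< n → ∀ {X p q u} → p ∈ X → q ∉ X →
            ¬ (∀ {x y} → x ∈ X → y ∉ X → s x y ≈ u)
    noCut 2<n {X} {u = u} p∈X q∉X cut with pigeonhole 2<n side
      where
      side : Fin n → Fin 2
      side x = if does (x ∈? X) then 0F else 1F
    ... | i , j , i<j , same with i ∈? X | j ∈? X | same
    ...   | yes i∈X | yes j∈X | _  =
      noClan (λ i j k i∈X j∈X k∉X → trans (cut i∈X k∉X) (sym (cut j∈X k∉X)))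
        i∈X j∈X (Fin.<⇒≢ i<j) q∉X
    ...   | no i∉X  | no j∉X  | _  =
      noClan (λ i j k i∈ j∈ k∉ → trans (below i∈ k∉) (sym (below j∈ k∉)))
        (x∉p⇒x∈∁p i∉X) (x∉p⇒x∈∁p j∉X) (Fin.<⇒≢ i<j) (λ p∈∁ → x∈∁p⇒x∉p p∈∁ p∈X)
      where
      below : ∀ {x k} → x ∈ ∁ X → k ∉ ∁ X → s x k ≈ - u
      below x∈ k∉ = trans (s-skew _ _) (-‿cong (cut (x∉∁p⇒x∈p k∉) (x∈∁p⇒x∉p x∈)))
    ...   | yes _   | no _    | ()
    ...   | no _    | yes _   | ()

  module _ {n} {A B : Matrix n} (TA : IsGeneralizedTournament A) (TB : IsGeneralizedTournament B)
    where

    Skewed-injective : (∀ i j → Skewed B i j ≈ Skewed A i j) → A ≋ B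
    Skewed-injective s′≈s i j with i Fin.≟ j
    ... | yes ≡.refl = trans (diagonal TA i) (sym (diagonal TB i))
    ... | no i≢j     = trans (entry TA i≢j)
      (trans (*-congˡ (+-congˡ (sym (s′≈s i j)))) (sym (entry TB i≢j)))

    Skewed-transpose : (∀ i j → Skewed B i j ≈ - Skewed A i j) → A ≋ B ᵗ
    Skewed-transpose s′≈-s i j with i Fin.≟ j
    ... | yes ≡.refl = trans (diagonal TA i) (sym (diagonal TB i))
    ... | no i≢j     = trans (entry TA i≢j) (trans (*-congˡ (+-congˡ
      (trans (sym (-‿involutive _)) (-‿cong (sym (s′≈-s i j)))))) (sym (entryᵗ TB i≢j)))

    reconstruct : 2 ℕ.< n → Indecomposable A → EqualMinors 4 A B → A ≋ B ⊎ A ≋ B ᵗ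
    reconstruct 2<n indecomposable minors
      with any? (λ i → any? (Colouring.P? C i)) | any? (λ i → any? (Colouring.R? C i))
      where C = colouring (equivalent TA TB minors)
    ... | yes (_ , _ , Pab) | yes (_ , _ , Rcd) =
      contradiction Rcd (monochromatic C (noClan TA indecomposable)
        (noCut TA indecomposable 2<n) Pab)
      where
      C = colouring (equivalent TA TB minors)
      open Connectivity ℝ {s = Skewed A}
    ... | no noP | _ = inj₂ (Skewed-transpose reversed)
      where
      eq = equivalent TA TB minors
      reversed : ∀ i j → Skewed B i j ≈ - Skewed A i j
      reversed i j with sign eq i j | Skewed A i j ≟ 0#
      ... | inj₂ e | _       = e
      -- A zero value is its own negative, so an uncoloured pair also counts as reversed.
      ... | inj₁ e | yes z   = trans e (trans z (trans (sym -0#≈0#) (-‿cong (sym z))))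
      ... | inj₁ e | no nz   = contradiction (i , j , nz , e) noP
    ... | _ | no noR = inj₁ (Skewed-injective preserved)
      where
      eq = equivalent TA TB minors
      preserved : ∀ i j → Skewed B i j ≈ Skewed A i j
      preserved i j with sign eq i j | Skewed A i j ≟ 0#
      ... | inj₁ e | _       = e
      ... | inj₂ e | yes z   = trans e (trans (-‿cong z) (trans -0#≈0# (sym z)))
      ... | inj₂ e | no nz   = contradiction (i , j , nz , e) noR


theorem4p1 : ∀ {c ℓ₁ ℓ₂} (ℝ : CompleteOrderedField c ℓ₁ ℓ₂) →
  let open CompleteOrderedField ℝ using (_≈_)
      open Matrices ℝ
  in (n : ℕ) → 4 ≤ n → (A B : Matrix n) →
     IsGeneralizedTournament A → IsGeneralizedTournament B →
     Indecomposable A →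
     ((X : Subset n) → ∣ X ∣ ≤ 4 → principalMinor A X ≈ principalMinor B X) →
     (A ≋ B) ⊎ (A ≋ B ᵗ)
theorem4p1 ℝ n 4≤n A B TA TB = Reconstruction.reconstruct ℝ TA TB (ℕ.<⇒≤ 4≤n)
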